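{- For any diagram $D=(k,m,r,P,Q)$, the collection $\mathcal{B}(D)$ of label-sets of b-paths of $D$ is the set of bases of a multi-path matroid on $[m+r]$.
   Context: A diagram is a 5-tuple $D=(k,m,r,P,Q)$ where $k$ is a positive integer, $m,r$ are non-negative integers, $P$ is a lattice path (steps $E=(1,0)$, $N=(0,1)$) from $(k-1,0)$ to $(k-1+m,r)$, and $Q$ is a lattice path from $(0,k-1)$ to $(m,k-1+r)$ that never goes below $P$. For $1\le i\le k$ let $p_i=(k-i,i-1)$ and $p'_i=p_i+(m,r)$; let $L,L'$ be the lines of slope $-1$ containing the $p_i$, resp. the $p'_i$. The region $R(D)$ is the set of points of $\mathbb{R}^2$, including the boundary, enclosed by $P$, $Q$, $L$, $L'$. An edge of $D$ (a unit segment between lattice points of $R(D)$) gets label $i$ if it is the $i$-th step of some lattice path starting at a point of $L$. A b-path is a lattice path contained in $R(D)$ from some $p_i$ to the corresponding $p'_i$; its label-set is the set of labels of its North steps. A multi-path matroid is a transversal matroid (matroid whose independent sets are the partial transversals of a multiset of subsets of the ground set) having a presentation by an antichain (no member containing another) of $\sigma$-intervals (nonempty sets $\{f,\sigma(f),\ldots,l\}$) for some cyclic permutation $\sigma$ of the ground set. -}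

module Defs where

open import Data.Nat using (ℕ; zero; suc; _+_; _∸_; _≤_)
open import Data.Product using (Σ; ∃; ∃₂; _×_; _,_; proj₁; proj₂)
open import Data.List using (List; []; _∷_; take; drop)
open import Data.List.Relation.Unary.All using (All)
open import Data.Fin using (Fin; toℕ)
open import Data.Fin.Subset using (Subset; _∈_; _⊆_)
open import Data.Fin.Permutation using (Permutation′; _⟨$⟩ʳ_)
open import Function.Bundles using (_⇔_)
open import Relation.Binary.PropositionalEquality using (_≡_; _≢_)
open import Relation.Nullary using (¬_)

data Step : Set where
  E N : Step

Point : Set
Point = ℕ × ℕ

move : Point → Step → Point
move (x , y) E = (suc x , y)
move (x , y) N = (x , suc y)

endpoint : Point → List Step → Point
endpoint p []       = p
endpoint p (s ∷ ss) = endpoint (move p s) ss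

points : Point → List Step → List Point
points p []       = p ∷ []
points p (s ∷ ss) = p ∷ points (move p s) ss

pointAt : Point → List Step → ℕ → Point
pointAt p ss j = endpoint p (take j ss)

-- Diagrams D = (k, m, r, P, Q)
-- P : (k-1,0) → (k-1+m, r),  Q : (0,k-1) → (m, k-1+r).
-- "Q never goes below P": on every anti-diagonal x+y = k-1+j the point of Q
-- is weakly above (= weakly to the upper left of) the point of P.

record Diagram : Set where
  field
    k      : ℕ
    k≥1    : 1 ≤ k
    m r    : ℕ
    P Q    : List Step
    P-path : endpoint (k ∸ 1 , 0) P ≡ (k ∸ 1 + m , r)
    Q-path : endpoint (0 , k ∸ 1) Q ≡ (m , k ∸ 1 + r)
    Q-not-below-P : ∀ j → proj₂ (pointAt (k ∸ 1 , 0) P j)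
                            ≤ proj₂ (pointAt (0 , k ∸ 1) Q j)

module _ (D : Diagram) where
  open Diagram D

  p : ℕ → Point
  p i = (k ∸ i , i ∸ 1)

  p′ : ℕ → Point
  p′ i = (k ∸ i + m , i ∸ 1 + r)

  -- Lattice points of the closed region R(D) bounded by P, Q, L, L'.
  -- L : x+y = k-1, L' : x+y = k-1+m+r.  A lattice point on the anti-diagonal
  -- x+y = k-1+j lies in R(D) iff its height is between those of P and Q there.
  InRegion : Point → Set
  InRegion (x , y) =
    (k ∸ 1 ≤ x + y) × (x + y ≤ k ∸ 1 + (m + r)) ×
    (proj₂ (pointAt (k ∸ 1 , 0) P (x + y ∸ (k ∸ 1))) ≤ y) ×
    (y ≤ proj₂ (pointAt (0 , k ∸ 1) Q (x + y ∸ (k ∸ 1))))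

  HasLabel : Point → Step → ℕ → Set
  HasLabel q s i =
    Σ Point λ st → Σ (List Step) λ ss → Σ (List Step) λ rest →
      (proj₁ st + proj₂ st ≡ k ∸ 1) × (1 ≤ i) ×
      (pointAt st ss (i ∸ 1) ≡ q) × (drop (i ∸ 1) ss ≡ s ∷ rest)

  record BPath : Set where
    field
      idx      : ℕ
      idx≥1    : 1 ≤ idx
      idx≤k    : idx ≤ k
      steps    : List Step
      ends     : endpoint (p idx) steps ≡ p′ idx
      inRegion : All InRegion (points (p idx) steps)

  NorthStepAt : BPath → Point → Set
  NorthStepAt β q =
    ∃₂ λ j rest → (drop j (BPath.steps β) ≡ N ∷ rest) ×
                  (pointAt (p (BPath.idx β)) (BPath.steps β) j ≡ q)

  InLabelSet : BPath → ℕ → Set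
  InLabelSet β ℓ = ∃ λ q → NorthStepAt β q × HasLabel q N ℓ

  -- B ⊆ [m+r] (element j : Fin (m+r) encodes the label j+1) lies in 𝓑(D)
  InB : Subset (m + r) → Set
  InB B = Σ BPath λ β →
    ∀ ℓ → InLabelSet β ℓ ⇔ (Σ (Fin (m + r)) λ j → (ℓ ≡ suc (toℕ j)) × (j ∈ B))

iter : ∀ {n} → Permutation′ n → ℕ → Fin n → Fin n
iter σ zero    e = e
iter σ (suc j) e = σ ⟨$⟩ʳ iter σ j e

IsCyclic : ∀ {n} → Permutation′ n → Set
IsCyclic σ = ∀ a b → ∃ λ j → iter σ j a ≡ b

IsσInterval : ∀ {n} → Permutation′ n → Subset n → Set
IsσInterval σ A = ∃₂ λ f t → ∀ e → (e ∈ A) ⇔ (∃ λ j → (j ≤ t) × (iter σ j f ≡ e))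

IsAntichain : ∀ {n c} → (Fin c → Subset n) → Set
IsAntichain A = ∀ i j → i ≢ j → ¬ (A i ⊆ A j)

PartialTransversal : ∀ {n c} → (Fin c → Subset n) → Subset n → Set
PartialTransversal {n} {c} A I =
  Σ ((e : Fin n) → e ∈ I → Fin c) λ φ →
    (∀ e (e∈I : e ∈ I) → e ∈ A (φ e e∈I)) ×
    (∀ e e′ (e∈I : e ∈ I) (e′∈I : e′ ∈ I) → φ e e∈I ≡ φ e′ e′∈I → e ≡ e′)

IsTransversalBasis : ∀ {n c} → (Fin c → Subset n) → Subset n → Set
IsTransversalBasis A B =
  PartialTransversal A B × (∀ B′ → B ⊆ B′ → PartialTransversal A B′ → B′ ⊆ B)

IsMultiPathBases : ∀ {n} → (Subset n → Set) → Set
IsMultiPathBases {n} 𝓑 =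
  Σ (Permutation′ n) λ σ → IsCyclic σ ×
  Σ ℕ λ c → Σ (Fin c → Subset n) λ A →
    (∀ i → IsσInterval σ (A i)) × IsAntichain A ×
    (∀ B → 𝓑 B ⇔ IsTransversalBasis A B)

{-# OPTIONS --safe #-}

-- A subset B of [n], n = m + r, is the label-set of a b-path starting at height a exactly when
-- ∣B∣ = r and lo j ≤ a + ∣B ∩ [j]∣ ≤ hi j for all j, where lo and hi are the heights of P and Q.
-- Extend lo and hi to ℕ by h (x + n) = h x + r.  The steps at which a path between them can rise
-- from height v to v + 1 form an interval, and modulo n it depends only on v mod r; the r resulting
-- cyclic intervals present the matroid.
-- * A b-path matches its North steps to the classes of their heights, so it gives a basis.
-- * Conversely, P is a full transversal, so bases have r elements; counting the elements of a basis
--   in each cyclic window bounds lo j − ∣B ∩ [j]∣ by hi j′ − ∣B ∩ [j′]∣ for all j, j′, and the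
--   maximum of the former is an admissible starting height a.
-- * Distinct intervals are incomparable once none has length n or more.  For r ≥ 2 this is achieved
--   by replacing hi x by min (hi x, lo (x − 2) + r): the lowest path with a given label-set touches
--   lo, and therefore stays below this bound.

module Submission where

open import Defs
open import Data.Bool using (true)
open import Data.Empty using (⊥; ⊥-elim)
open import Data.Fin using (Fin; zero; suc; fromℕ<; toℕ)
open import Data.Fin.Permutation using (Permutation′; permutation) renaming (id to idₚ)
open import Data.Fin.Properties
  using (any?; ¬∀⟶∃¬; toℕ-injective; toℕ-fromℕ<; fromℕ<-injective; toℕ<n)
  renaming (_≟_ to _≟ᶠ_; suc-injective to sucᶠ-injective)
open import Data.Fin.Subset
  using (Subset; inside; outside; _∈_; _∉_; _⊆_; _⊂_; _∩_; _∪_; _-_; ∁; ∣_∣; ⊤; ⁅_⁆)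
open import Data.Fin.Subset.Induction using (⊂-wellFounded; Acc; acc)
open import Data.Fin.Subset.Properties
open import Data.List using (List; []; _∷_; drop; length)
open import Data.List.Properties using (take-all)
open import Data.List.Relation.Unary.All using (All; []; _∷_)
open import Data.Nat
open import Data.Nat.Divisibility using (n∣m*n)
open import Data.Nat.DivMod
open import Data.Nat.Properties
open import Data.Nat.Tactic.RingSolver using (solve-∀)
open import Data.Product using (∃; _×_; _,_; proj₁; proj₂)
open import Data.Sum using (_⊎_; inj₁; inj₂)
open import Data.Vec using ([]; _∷_; tabulate; here; there)
open import Data.Vec.Functional using (updateAt)
open import Data.Vec.Functional.Properties using (updateAt-updates; updateAt-minimal)
open import Data.Vec.Properties using (lookup⇒[]=; []=⇒lookup; lookup∘tabulate)
open import Function using (_⇔_; mk⇔; Equivalence; const; _∘_)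
open import Function.Properties.Equivalence using () renaming (trans to ⇔-trans)
open import Relation.Binary.Definitions using (tri<; tri≈; tri>)
open import Relation.Binary.PropositionalEquality
open import Relation.Nullary using (¬_; Dec; yes; no; does; contradiction; ¬?)
open import Relation.Nullary.Decidable using (dec-true; _×-dec_; _⊎-dec_)
open import Relation.Unary using (Decidable)

-- Finite subsets: comprehension and cardinality

⟦_⟧ : ∀ {n} {P : Fin n → Set} → Decidable P → Subset n
⟦ P? ⟧ = tabulate (does ∘ P?)

∈⟦⟧⁺ : ∀ {n} {P : Fin n → Set} (P? : Decidable P) {i} → P i → i ∈ ⟦ P? ⟧
∈⟦⟧⁺ P? {i} p = lookup⇒[]= i _ (trans (lookup∘tabulate (does ∘ P?) i) (dec-true (P? i) p))

∈⟦⟧⁻ : ∀ {n} {P : Fin n → Set} (P? : Decidable P) {i} → i ∈ ⟦ P? ⟧ → P i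
∈⟦⟧⁻ {P = P} P? {i} i∈ =
  holds (P? i) (trans (sym (lookup∘tabulate (does ∘ P?) i)) ([]=⇒lookup i∈))
  where
  holds : (d : Dec (P i)) → does d ≡ true → P i
  holds (yes p) _ = p

∣p∣≡∣p∩q∣+∣p∩∁q∣ : ∀ {n} (p q : Subset n) → ∣ p ∣ ≡ ∣ p ∩ q ∣ + ∣ p ∩ ∁ q ∣
∣p∣≡∣p∩q∣+∣p∩∁q∣ []            []            = refl
∣p∣≡∣p∩q∣+∣p∩∁q∣ (outside ∷ p) (_       ∷ q) = ∣p∣≡∣p∩q∣+∣p∩∁q∣ p q
∣p∣≡∣p∩q∣+∣p∩∁q∣ (inside  ∷ p) (inside  ∷ q) = cong suc (∣p∣≡∣p∩q∣+∣p∩∁q∣ p q)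
∣p∣≡∣p∩q∣+∣p∩∁q∣ (inside  ∷ p) (outside ∷ q) =
  trans (cong suc (∣p∣≡∣p∩q∣+∣p∩∁q∣ p q)) (sym (+-suc _ _))

-- Induction on `S`, deleting the image of the first element from `T`. The map takes the membership
-- proof as an argument, in the form of the matchings in `PartialTransversal`.
injection⇒∣∣≤ : ∀ {n c} (S : Subset n) (T : Subset c) (f : ∀ e → e ∈ S → Fin c) →
  (∀ e e∈ → f e e∈ ∈ T) →
  (∀ e e′ e∈ e′∈ → f e e∈ ≡ f e′ e′∈ → e ≡ e′) → ∣ S ∣ ≤ ∣ T ∣
injection⇒∣∣≤ []            T f f∈ inj = z≤n
injection⇒∣∣≤ (outside ∷ S) T f f∈ inj =
  injection⇒∣∣≤ S T (λ e e∈ → f (suc e) (there e∈)) (λ e e∈ → f∈ (suc e) (there e∈))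
    (λ e e′ e∈ e′∈ eq → sucᶠ-injective (inj _ _ _ _ eq))
injection⇒∣∣≤ (inside ∷ S) T f f∈ inj =
  ≤-trans
    (s≤s (injection⇒∣∣≤ S (T - f zero here) (λ e e∈ → f (suc e) (there e∈))
      (λ e e∈ → x∈p∧x≢y⇒x∈p-y (f∈ (suc e) (there e∈)) (λ eq → 0≢ (inj _ _ _ _ eq)))
      (λ e e′ e∈ e′∈ eq → sucᶠ-injective (inj _ _ _ _ eq))))
    (x∈p⇒∣p-x∣<∣p∣ (f∈ zero here))
  where
  0≢ : ∀ {n} {e : Fin n} → ¬ (Fin.suc e ≡ zero)
  0≢ ()

transversal-size : ∀ {n c} {A : Fin c → Subset n} {I} → PartialTransversal A I → ∣ I ∣ ≤ c
transversal-size {c = c} {I = I} (φ , _ , inj) =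
  ≤-trans (injection⇒∣∣≤ I ⊤ φ (λ _ _ → ∈⊤) inj) (≤-reflexive (∣⊤∣≡n c))

-- Augmenting partial transversals along a full transversal `ψ`

module _ {n c} (A : Fin c → Subset n)
  (ψ : Fin c → Fin n) (ψ∈ : ∀ t → ψ t ∈ A t) (ψ-inj : ∀ {s t} → ψ s ≡ ψ t → s ≡ t)
  (I : Subset n) where

  private
    Matching : (Fin n → Fin c) → Set
    Matching g = (∀ e → e ∈ I → e ∈ A (g e)) ×
                 (∀ e e′ → e ∈ I → e′ ∈ I → g e ≡ g e′ → e ≡ e′)

    Unmatched : (Fin n → Fin c) → Fin c → Set
    Unmatched g t = ∀ e → e ∈ I → g e ≢ t

    -- Termination measure of `augment`: the classes at which the matching differs from the inverse
    -- of `ψ`.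
    disagreement : (Fin n → Fin c) → Subset c
    disagreement g = ⟦ (λ s → ¬? (g (ψ s) ≟ᶠ s)) ⟧

    Extension : Set
    Extension = ∃ λ x → x ∉ I × PartialTransversal A (I ∪ ⁅ x ⁆)

    update : (Fin n → Fin c) → Fin c → Fin n → Fin c
    update g t = updateAt g (ψ t) (const t)

    update-here : ∀ g t {e} → e ≡ ψ t → update g t e ≡ t
    update-here g t refl = updateAt-updates (ψ t) g

    update-there : ∀ g t {e} → e ≢ ψ t → update g t e ≡ g e
    update-there g t {e} e≢ = updateAt-minimal e (ψ t) g e≢

    -- The weakened membership hypothesis serves both branches of `augment`: `ψ t` may be new to `I`
    -- or already in it.
    update-∈ : ∀ g t → Matching g → ∀ e → (e ≢ ψ t → e ∈ I) → e ∈ A (update g t e)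
    update-∈ g t (g∈ , _) e e∈ with e ≟ᶠ ψ t
    ... | yes eq = subst (λ u → e ∈ A u) (sym (update-here g t eq))
                     (subst (_∈ A t) (sym eq) (ψ∈ t))
    ... | no ne = subst (λ u → e ∈ A u) (sym (update-there g t ne)) (g∈ e (e∈ ne))

    update-inj : ∀ g t → Matching g → Unmatched g t → ∀ e e′ →
      (e ≢ ψ t → e ∈ I) → (e′ ≢ ψ t → e′ ∈ I) → update g t e ≡ update g t e′ → e ≡ e′
    update-inj g t (_ , inj) free e e′ e∈ e′∈ eq with e ≟ᶠ ψ t | e′ ≟ᶠ ψ t
    ... | yes p | yes q = trans p (sym q)
    ... | yes p | no q = contradiction
            (trans (sym (update-there g t q)) (trans (sym eq) (update-here g t p)))
            (free e′ (e′∈ q))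
    ... | no p | yes q = contradiction
            (trans (sym (update-there g t p)) (trans eq (update-here g t q)))
            (free e (e∈ p))
    ... | no p | no q = inj e e′ (e∈ p) (e′∈ q)
            (trans (sym (update-there g t p)) (trans eq (update-there g t q)))

    -- Rematching ψ t to t frees the class it had before and makes g agree with
    -- ψ⁻¹ in one more place.
    augment : ∀ g → Acc _⊂_ (disagreement g) → Matching g → ∀ t → Unmatched g t → Extension
    augment g (acc rec) M@(g∈ , inj) t free with ψ t ∈? I
    ... | no ψt∉ =
          ψ t , ψt∉ , (λ e _ → update g t e) ,
          (λ e e∈ → update-∈ g t M e (old e∈)) ,
          (λ e e′ e∈ e′∈ → update-inj g t M free e e′ (old e∈) (old e′∈))
      where
      old : ∀ {e} → e ∈ I ∪ ⁅ ψ t ⁆ → e ≢ ψ t → e ∈ I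
      old e∈ ne with x∈p∪q⁻ I ⁅ ψ t ⁆ e∈
      ... | inj₁ e∈I = e∈I
      ... | inj₂ e∈s = contradiction (x∈⁅y⁆⇒x≡y _ e∈s) ne
    ... | yes ψt∈ = augment g′ (rec smaller)
          ((λ e e∈ → update-∈ g t M e (const e∈)) ,
           (λ e e′ e∈ e′∈ → update-inj g t M free e e′ (const e∈) (const e′∈)))
          (g (ψ t)) free′
      where
      g′ : Fin n → Fin c
      g′ = update g t

      free′ : Unmatched g′ (g (ψ t))
      free′ e e∈ eq with e ≟ᶠ ψ t
      ... | yes p = free (ψ t) ψt∈ (trans (sym eq) (update-here g t p))
      ... | no p = p (inj e (ψ t) e∈ ψt∈ (trans (sym (update-there g t p)) eq))

      smaller : disagreement g′ ⊂ disagreement g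
      smaller = shrink , t , ∈⟦⟧⁺ (λ s → ¬? (g (ψ s) ≟ᶠ s)) (free (ψ t) ψt∈) ,
                λ t∈ → ∈⟦⟧⁻ (λ s → ¬? (g′ (ψ s) ≟ᶠ s)) t∈ (update-here g t refl)
        where
        shrink : disagreement g′ ⊆ disagreement g
        shrink {s} s∈ = ∈⟦⟧⁺ (λ s → ¬? (g (ψ s) ≟ᶠ s)) agree
          where
          agree : g (ψ s) ≢ s
          agree eq with s ≟ᶠ t
          ... | yes refl = free (ψ t) ψt∈ eq
          ... | no s≢t = ∈⟦⟧⁻ (λ s → ¬? (g′ (ψ s) ≟ᶠ s)) s∈
                           (trans (update-there g t (s≢t ∘ ψ-inj)) eq)

  -- By pigeonhole some class is unmatched, and augmentation starts there.
  transversal-extends : ∣ I ∣ < c → PartialTransversal A I → Extension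
  transversal-extends ∣I∣<c (φ , φ∈ , φ-inj) =
    let t , free = unmatched in
    augment g (⊂-wellFounded _) (g∈ , g-inj) t (λ e e∈ eq → free (e , e∈ , eq))
    where
    g : Fin n → Fin c
    g e with e ∈? I
    ... | yes e∈ = φ e e∈
    -- An arbitrary default off `I`; `∣ I ∣ < c` shows that `Fin c` is inhabited.
    ... | no _   = fromℕ< (≤-<-trans z≤n ∣I∣<c)

    g≡φ : ∀ e → e ∈ I → ∃ λ e∈ → g e ≡ φ e e∈
    g≡φ e e∈ with e ∈? I
    ... | yes e∈′ = e∈′ , refl
    ... | no e∉   = contradiction e∈ e∉

    g∈ : ∀ e → e ∈ I → e ∈ A (g e)
    g∈ e e∈ = let e∈′ , eq = g≡φ e e∈ in subst (λ u → e ∈ A u) (sym eq) (φ∈ e e∈′)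

    g-inj : ∀ e e′ → e ∈ I → e′ ∈ I → g e ≡ g e′ → e ≡ e′
    g-inj e e′ e∈ e′∈ eq =
      φ-inj e e′ _ _ (trans (sym (proj₂ (g≡φ e e∈))) (trans eq (proj₂ (g≡φ e′ e′∈))))

    matched? : ∀ t → Dec (∃ λ e → e ∈ I × g e ≡ t)
    matched? t = any? (λ e → (e ∈? I) ×-dec (g e ≟ᶠ t))

    not-all-matched : ¬ (∀ t → ∃ λ e → e ∈ I × g e ≡ t)
    not-all-matched all = <⇒≱ ∣I∣<c (≤-trans (≤-reflexive (sym (∣⊤∣≡n c)))
      (injection⇒∣∣≤ ⊤ I (λ t _ → proj₁ (all t)) (λ t _ → proj₁ (proj₂ (all t)))
        (λ t t′ _ _ eq → trans (sym (proj₂ (proj₂ (all t))))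
                           (trans (cong g eq) (proj₂ (proj₂ (all t′)))))))

    unmatched : ∃ λ t → ¬ (∃ λ e → e ∈ I × g e ≡ t)
    unmatched = ¬∀⟶∃¬ c _ matched? not-all-matched

  -- A smaller basis would extend by an element outside it, against maximality.
  transversal-basis-size : IsTransversalBasis A I → ∣ I ∣ ≡ c
  transversal-basis-size (T , maximal) with m≤n⇒m<n∨m≡n (transversal-size {A = A} T)
  ... | inj₂ eq = eq
  ... | inj₁ lt =
    let x , x∉ , T′ = transversal-extends lt T in
    contradiction (maximal _ (p⊆p∪q _) T′ (x∈p∪q⁺ (inj₂ (x∈⁅x⁆ x)))) x∉

-- Residues, crossings and extremal shifts

-- With equal remainders, `x < y` forces a larger quotient for `y`, and then `x + r ≤ y`.
residue-gap : ∀ {x y} r .{{_ : NonZero r}} → x < y → y < x + r → x % r ≢ y % r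
residue-gap {x} {y} r x<y y<x+r eq = <⇒≱ y<x+r (begin
  x + r                       ≡⟨ cong (_+ r) (m≡m%n+[m/n]*n x r) ⟩
  x % r + x / r * r + r       ≡⟨ +-assoc (x % r) _ _ ⟩
  x % r + (x / r * r + r)     ≡⟨ cong (x % r +_) (+-comm (x / r * r) r) ⟩
  x % r + (suc (x / r)) * r   ≤⟨ +-monoʳ-≤ (x % r) (*-monoˡ-≤ r x/r<y/r) ⟩
  x % r + y / r * r           ≡⟨ cong (_+ y / r * r) eq ⟩
  y % r + y / r * r           ≡⟨ m≡m%n+[m/n]*n y r ⟨
  y                           ∎)
  where
  open ≤-Reasoning
  x/r<y/r : x / r < y / r
  x/r<y/r = ≰⇒> λ le → <⇒≱ x<y (begin
    y                  ≡⟨ m≡m%n+[m/n]*n y r ⟩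
    y % r + y / r * r  ≤⟨ +-mono-≤ (≤-reflexive (sym eq)) (*-monoˡ-≤ r le) ⟩
    x % r + x / r * r  ≡⟨ m≡m%n+[m/n]*n x r ⟨
    x                  ∎)

-- Discrete intermediate value theorem, by descending from `n` until `f` no longer exceeds `t`.
crossing : ∀ (f : ℕ → ℕ) n {t} → f 0 ≤ t → t < f n → ∃ λ x → x < n × f x ≤ t × t < f (suc x)
crossing f zero    f0≤t t<f = contradiction f0≤t (<⇒≱ t<f)
crossing f (suc n) {t} f0≤t t<f with t <? f n
... | yes t<fn = let x , x<n , p = crossing f n f0≤t t<fn in x , m<n⇒m<1+n x<n , p
... | no  t≮fn = n , ≤-refl , ≮⇒≥ t≮fn , t<f

-- The shift `a` is the maximum of `f j - g j` over `j ≤ n`, attained at `i`; equality at 0 makes it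
-- non-negative. For `f = lo` and `g = count< B` it is the lowest starting height that keeps the
-- path with label-set `B` above `lo`.
least-shift : ∀ (f g : ℕ → ℕ) → f 0 ≡ g 0 → ∀ n →
  ∃ λ a → (∃ λ i → i ≤ n × f i ≡ a + g i) × (∀ j → j ≤ n → f j ≤ a + g j)
least-shift f g eq zero = 0 , (0 , z≤n , eq) , λ { _ z≤n → ≤-reflexive eq }
least-shift f g eq (suc n) with least-shift f g eq n
... | a , (i , i≤n , fi≡) , bound with f (suc n) ≤? a + g (suc n)
...   | yes le = a , (i , m≤n⇒m≤1+n i≤n , fi≡) , bound′
  where
  bound′ : ∀ j → j ≤ suc n → f j ≤ a + g j
  bound′ j j≤ with m≤n⇒m<n∨m≡n j≤
  ... | inj₁ (s≤s j≤n) = bound j j≤n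
  ... | inj₂ refl = le
...   | no ≰ = b , (suc n , ≤-refl , sym b+g≡f) , bound′
  where
  b = f (suc n) ∸ g (suc n)
  b+g≡f : b + g (suc n) ≡ f (suc n)
  b+g≡f = m∸n+n≡m (≤-trans (m≤n+m _ a) (<⇒≤ (≰⇒> ≰)))
  a≤b : a ≤ b
  a≤b = +-cancelʳ-≤ (g (suc n)) a b (≤-trans (<⇒≤ (≰⇒> ≰)) (≤-reflexive (sym b+g≡f)))
  bound′ : ∀ j → j ≤ suc n → f j ≤ b + g j
  bound′ j j≤ with m≤n⇒m<n∨m≡n j≤
  ... | inj₁ (s≤s j≤n) = ≤-trans (bound j j≤n) (+-monoˡ-≤ (g j) a≤b)
  ... | inj₂ refl = ≤-reflexive (sym b+g≡f)

monotone : ∀ {f : ℕ → ℕ} → (∀ x → f x ≤ f (suc x)) → ∀ {x y} → x ≤ y → f x ≤ f y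
monotone {f} up {x} {y} x≤y = go (≤⇒≤′ x≤y)
  where
  go : ∀ {y} → x ≤′ y → f x ≤ f y
  go ≤′-refl = ≤-refl
  go (≤′-step p) = ≤-trans (go p) (up _)

-- Counting the elements of a subset in a window

-- The number `∣B ∩ [j]∣`: the height gained in the first `j` steps of the path with label-set `B`.
count< : ∀ {n} → Subset n → ℕ → ℕ
count< []            _       = 0
count< (_ ∷ _)       zero    = 0
count< (inside ∷ B)  (suc j) = suc (count< B j)
count< (outside ∷ B) (suc j) = count< B j

count<-zero : ∀ {n} (B : Subset n) → count< B 0 ≡ 0
count<-zero []      = refl
count<-zero (_ ∷ _) = refl

count<-all : ∀ {n} (B : Subset n) → count< B n ≡ ∣ B ∣
count<-all []            = refl
count<-all (inside ∷ B)  = cong suc (count<-all B)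
count<-all (outside ∷ B) = count<-all B

count<-up : ∀ {n} (B : Subset n) j → count< B j ≤ count< B (suc j)
count<-up []            j       = z≤n
count<-up (_ ∷ B)       zero    = z≤n
count<-up (inside ∷ B)  (suc j) = s≤s (count<-up B j)
count<-up (outside ∷ B) (suc j) = count<-up B j

count<-step : ∀ {n} (B : Subset n) j → count< B (suc j) ≤ suc (count< B j)
count<-step []            j       = z≤n
count<-step (inside ∷ B)  zero    = ≤-reflexive (cong suc (count<-zero B))
count<-step (outside ∷ B) zero    = ≤-trans (≤-reflexive (count<-zero B)) z≤n
count<-step (inside ∷ B)  (suc j) = s≤s (count<-step B j)
count<-step (outside ∷ B) (suc j) = count<-step B j

count<-∈ : ∀ {n} {B : Subset n} {e} → e ∈ B → count< B (suc (toℕ e)) ≡ suc (count< B (toℕ e))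
count<-∈ {B = _ ∷ B}       here       = cong suc (count<-zero B)
count<-∈ {B = inside ∷ _}  (there e∈) = cong suc (count<-∈ e∈)
count<-∈ {B = outside ∷ _} (there e∈) = count<-∈ e∈

count<≤∣∣ : ∀ {n} (B : Subset n) j → count< B j ≤ ∣ B ∣
count<≤∣∣ []            j       = z≤n
count<≤∣∣ (_ ∷ B)       zero    = z≤n
count<≤∣∣ (inside ∷ B)  (suc j) = s≤s (count<≤∣∣ B j)
count<≤∣∣ (outside ∷ B) (suc j) = count<≤∣∣ B j

below : ∀ {n} → ℕ → Subset n
below j = ⟦ (λ e → toℕ e <? j) ⟧

∣∩below∣ : ∀ {n} (B : Subset n) j → ∣ B ∩ below j ∣ ≡ count< B j
∣∩below∣ []            j       = refl
∣∩below∣ (inside ∷ B)  zero    = trans (∣∩below∣ B zero) (count<-zero B)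
∣∩below∣ (outside ∷ B) zero    = trans (∣∩below∣ B zero) (count<-zero B)
∣∩below∣ (inside ∷ B)  (suc j) = cong suc (∣∩below∣ B j)
∣∩below∣ (outside ∷ B) (suc j) = ∣∩below∣ B j

module _ {n} (B S : Subset n) {i j : ℕ} where
  private
    lt : ∀ {k} {e : Fin n} → e ∈ below k → toℕ e < k
    lt {k} = ∈⟦⟧⁻ (λ e → toℕ e <? k)

    ge : ∀ {k} {e : Fin n} → e ∈ ∁ (below k) → k ≤ toℕ e
    ge e∈ = ≮⇒≥ λ e< → x∈∁p⇒x∉p e∈ (∈⟦⟧⁺ (λ e → toℕ e <? _) e<)

  -- Split `B ∩ [j]` at `i`: the part from `i` on lies in `S`.
  count<-window : (∀ e → i ≤ toℕ e → toℕ e < j → e ∈ S) → count< B j ≤ count< B i + ∣ B ∩ S ∣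
  count<-window S⊇ = begin
    count< B j                                                                  ≡⟨ ∣∩below∣ B j ⟨
    ∣ B ∩ below j ∣
      ≡⟨ ∣p∣≡∣p∩q∣+∣p∩∁q∣ (B ∩ below j) (below i) ⟩
    ∣ (B ∩ below j) ∩ below i ∣ + ∣ (B ∩ below j) ∩ ∁ (below i) ∣
      ≤⟨ +-mono-≤ (p⊆q⇒∣p∣≤∣q∣ before) (p⊆q⇒∣p∣≤∣q∣ between) ⟩
    ∣ B ∩ below i ∣ + ∣ B ∩ S ∣                                            ≡⟨ cong (_+ _) (∣∩below∣ B i) ⟩
    count< B i + ∣ B ∩ S ∣                                                      ∎
    where
    open ≤-Reasoning
    before : (B ∩ below j) ∩ below i ⊆ B ∩ below i
    before x∈ = let x∈Bj , x∈i = x∈p∩q⁻ (B ∩ below j) (below i) x∈ in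
      x∈p∩q⁺ (proj₁ (x∈p∩q⁻ B (below j) x∈Bj) , x∈i)
    between : (B ∩ below j) ∩ ∁ (below i) ⊆ B ∩ S
    between x∈ =
      let x∈Bj , x∉i = x∈p∩q⁻ (B ∩ below j) (∁ (below i)) x∈
          x∈B , x∈j = x∈p∩q⁻ B (below j) x∈Bj
      in x∈p∩q⁺ (x∈B , S⊇ _ (ge x∉i) (lt x∈j))

  -- Here `S` contains the cyclic window from `i` around to `j`. Elements of `B` outside `S` lie
  -- between `j` and `i`, so there are at most `count< B i - count< B j` of them; the additive form
  -- avoids truncated subtraction.
  count<-cowindow : j ≤ i → (∀ e → toℕ e < j ⊎ i ≤ toℕ e → e ∈ S) →
               ∣ B ∣ + count< B j ≤ ∣ B ∩ S ∣ + count< B i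
  count<-cowindow j≤i S⊇ = begin
    ∣ B ∣ + count< B j
      ≡⟨ cong₂ _+_ (∣p∣≡∣p∩q∣+∣p∩∁q∣ B S) (sym (∣∩below∣ B j)) ⟩
    ∣ B ∩ S ∣ + ∣ B ∩ ∁ S ∣ + ∣ B ∩ below j ∣  ≡⟨ +-assoc ∣ B ∩ S ∣ _ _ ⟩
    ∣ B ∩ S ∣ + (∣ B ∩ ∁ S ∣ + ∣ B ∩ below j ∣) ≡⟨ cong (∣ B ∩ S ∣ +_) (+-comm ∣ B ∩ ∁ S ∣ _) ⟩
    ∣ B ∩ S ∣ + (∣ B ∩ below j ∣ + ∣ B ∩ ∁ S ∣)
      ≤⟨ +-monoʳ-≤ ∣ B ∩ S ∣ (+-mono-≤ (p⊆q⇒∣p∣≤∣q∣ before) (p⊆q⇒∣p∣≤∣q∣ between)) ⟩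
    ∣ B ∩ S ∣ + (∣ (B ∩ below i) ∩ below j ∣ + ∣ (B ∩ below i) ∩ ∁ (below j) ∣)
      ≡⟨ cong (∣ B ∩ S ∣ +_) (∣p∣≡∣p∩q∣+∣p∩∁q∣ (B ∩ below i) (below j)) ⟨
    ∣ B ∩ S ∣ + ∣ B ∩ below i ∣                 ≡⟨ cong (∣ B ∩ S ∣ +_) (∣∩below∣ B i) ⟩
    ∣ B ∩ S ∣ + count< B i                           ∎
    where
    open ≤-Reasoning
    below-mono : ∀ {x} → x ∈ below {n} j → x ∈ below i
    below-mono x∈ = ∈⟦⟧⁺ (λ e → toℕ e <? i) (<-≤-trans (lt x∈) j≤i)
    before : B ∩ below j ⊆ (B ∩ below i) ∩ below j
    before x∈ = let x∈B , x∈j = x∈p∩q⁻ B (below j) x∈ in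
      x∈p∩q⁺ (x∈p∩q⁺ (x∈B , below-mono x∈j) , x∈j)
    between : B ∩ ∁ S ⊆ (B ∩ below i) ∩ ∁ (below j)
    between {x} x∈ =
      let x∈B , x∈∁S = x∈p∩q⁻ B (∁ S) x∈
          x∉S = x∈∁p⇒x∉p x∈∁S
      in x∈p∩q⁺
           ( x∈p∩q⁺ (x∈B , ∈⟦⟧⁺ (λ e → toℕ e <? i) (≰⇒> λ i≤ → x∉S (S⊇ x (inj₂ i≤))))
           , x∉p⇒x∈∁p (λ x∈j → x∉S (S⊇ x (inj₁ (lt x∈j)))))

-- Subtracting `u` turns `v` into an injection into `Fin (w ∸ u)`; the hypothesis `u ≤ w` carries
-- the case of empty `S`.
injection-into-interval : ∀ {n} (S : Subset n) {u w} → u ≤ w → (v : ∀ e → e ∈ S → ℕ) →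
  (∀ e e∈ → u ≤ v e e∈) → (∀ e e∈ → v e e∈ < w) →
  (∀ e e′ e∈ e′∈ → v e e∈ ≡ v e′ e′∈ → e ≡ e′) → u + ∣ S ∣ ≤ w
injection-into-interval S {u} {w} u≤w v lb ub inj = begin
  u + ∣ S ∣          ≤⟨ +-monoʳ-≤ u (injection⇒∣∣≤ S ⊤ (λ e e∈ → fromℕ< (small e e∈)) (λ _ _ → ∈⊤)
                        λ e e′ e∈ e′∈ eq → inj e e′ e∈ e′∈
                          (∸-cancelʳ-≡ (lb e e∈) (lb e′ e′∈) (fromℕ<-injective _ _ _ _ eq))) ⟩
  u + ∣ ⊤ {w ∸ u} ∣  ≡⟨ cong (u +_) (∣⊤∣≡n (w ∸ u)) ⟩
  u + (w ∸ u)        ≡⟨ m+[n∸m]≡n u≤w ⟩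
  w                  ∎
  where
  open ≤-Reasoning
  small : ∀ e e∈ → v e e∈ ∸ u < w ∸ u
  small e e∈ = ∸-monoˡ-< (ub e e∈) (lb e e∈)

-- Periodic strips and their transversal presentation

-- a is the height at which the b-path with label-set B starts (idx ∸ 1 in BPath).
Fits : ∀ {n} → ℕ → (lo hi : ℕ → ℕ) → Subset n → Set
Fits {n} r lo hi B =
  ∣ B ∣ ≡ r × ∃ λ a → ∀ j → j ≤ n → lo j ≤ a + count< B j × a + count< B j ≤ hi j

-- The region between the boundaries, unrolled: `n` positions further on it repeats `r` higher.
-- Positions modulo `n` are elements of the ground set, heights modulo `r` are members of the
-- presentation.
record Strip (n r : ℕ) (lo hi : ℕ → ℕ) : Set where
  field
    lo-zero   : lo 0 ≡ 0
    lo-period : ∀ x → lo (x + n) ≡ lo x + r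
    hi-period : ∀ x → hi (x + n) ≡ hi x + r
    lo-up     : ∀ x → lo x ≤ lo (suc x)
    hi-up     : ∀ x → hi x ≤ hi (suc x)
    lo-step   : ∀ x → lo (suc x) ≤ suc (lo x)
    hi-step   : ∀ x → hi (suc x) ≤ suc (hi x)
    lo≤hi     : ∀ x → lo x ≤ hi x

  lo-mono : ∀ {x y} → x ≤ y → lo x ≤ lo y
  lo-mono = monotone {lo} lo-up

  hi-mono : ∀ {x y} → x ≤ y → hi x ≤ hi y
  hi-mono = monotone {hi} hi-up

  lo-n : lo n ≡ r
  lo-n = trans (lo-period 0) (cong (_+ r) lo-zero)

-- Some path between lo and hi can rise at step e from a height congruent to t modulo r.
MeetsClass : ∀ {n} (r : ℕ) .{{_ : NonZero r}} (lo hi : ℕ → ℕ) → Fin r → Fin n → Set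
MeetsClass r lo hi t e =
  ∃ λ v → v < hi (suc (toℕ e)) × (v % r ≡ toℕ t × lo (toℕ e) ≤ v)

meetsClass? : ∀ {n} r .{{_ : NonZero r}} lo hi t (e : Fin n) → Dec (MeetsClass r lo hi t e)
meetsClass? r lo hi t e =
  anyUpTo? (λ v → (v % r ≟ toℕ t) ×-dec (lo (toℕ e) ≤? v)) (hi (suc (toℕ e)))

rows : ∀ {n} r .{{_ : NonZero r}} (lo hi : ℕ → ℕ) → Fin r → Subset n
rows r lo hi t = ⟦ meetsClass? r lo hi t ⟧

module _ {n r lo hi} .{{_ : NonZero r}} (strip : Strip n r lo hi) where
  open Strip strip

  private
    A : Fin r → Subset n
    A = rows r lo hi

    ∈A⁺ : ∀ {t e} → MeetsClass r lo hi t e → e ∈ A t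
    ∈A⁺ {t} = ∈⟦⟧⁺ (meetsClass? r lo hi t)

    ∈A⁻ : ∀ {t e} → e ∈ A t → MeetsClass r lo hi t e
    ∈A⁻ {t} = ∈⟦⟧⁻ (meetsClass? r lo hi t)

  -- The lower boundary provides the full transversal: `ψ t` is the step at which `lo` rises from
  -- height `t`.
  rows-basis-size : ∀ {B} → IsTransversalBasis A B → ∣ B ∣ ≡ r
  rows-basis-size {B} = transversal-basis-size A ψ ψ∈ ψ-inj B
    where
    step : ∀ (t : Fin r) → ∃ λ x → x < n × lo x ≤ toℕ t × toℕ t < lo (suc x)
    step t = crossing lo n (≤-trans (≤-reflexive lo-zero) z≤n)
               (<-≤-trans (toℕ<n t) (≤-reflexive (sym lo-n)))

    ψ : Fin r → Fin n
    ψ t = fromℕ< (proj₁ (proj₂ (step t)))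

    toℕ-ψ : ∀ t → toℕ (ψ t) ≡ proj₁ (step t)
    toℕ-ψ t = toℕ-fromℕ< _

    lo-ψ : ∀ t → lo (toℕ (ψ t)) ≡ toℕ t
    lo-ψ t = let x , _ , lo≤t , t<lo = step t in
      trans (cong lo (toℕ-ψ t)) (≤-antisym lo≤t (s≤s⁻¹ (≤-trans t<lo (lo-step x))))

    ψ∈ : ∀ t → ψ t ∈ A t
    ψ∈ t = let x , _ , lo≤t , t<lo = step t in
      ∈A⁺ (toℕ t ,
        subst (λ y → toℕ t < hi (suc y)) (sym (toℕ-ψ t)) (<-≤-trans t<lo (lo≤hi (suc x))) ,
        m<n⇒m%n≡m (toℕ<n t) , ≤-reflexive (lo-ψ t))

    ψ-inj : ∀ {s t} → ψ s ≡ ψ t → s ≡ t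
    ψ-inj {s} {t} eq =
      toℕ-injective (trans (sym (lo-ψ s)) (trans (cong (λ e → lo (toℕ e)) eq) (lo-ψ t)))

  -- Starting at the maximum `a` of `lo j - count< B j` gives the lower bounds at once. The upper
  -- bound at `j` comes from comparing `j` with the position `i` where this maximum is attained.
  transversal⇒fits : ∀ {B} → ∣ B ∣ ≡ r → PartialTransversal A B → Fits r lo hi B
  transversal⇒fits {B} ∣B∣≡r (φ , φ∈ , φ-inj)
    with least-shift lo (count< B) (trans lo-zero (sym (count<-zero B))) n
  ... | a , (i , i≤n , lo-i) , above = ∣B∣≡r , a , λ j j≤n → above j j≤n , within j j≤n
    where
    open ≤-Reasoning

    v : ∀ e → e ∈ B → ℕ
    v e e∈ = proj₁ (∈A⁻ (φ∈ e e∈))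

    v-ub : ∀ e e∈ → v e e∈ < hi (suc (toℕ e))
    v-ub e e∈ = proj₁ (proj₂ (∈A⁻ (φ∈ e e∈)))

    v-lb : ∀ e e∈ → lo (toℕ e) ≤ v e e∈
    v-lb e e∈ = proj₂ (proj₂ (proj₂ (∈A⁻ (φ∈ e e∈))))

    v-inj : ∀ e e′ e∈ e′∈ → v e e∈ % r ≡ v e′ e′∈ % r → e ≡ e′
    v-inj e e′ e∈ e′∈ eq = φ-inj e e′ e∈ e′∈ (toℕ-injective
      (trans (sym (proj₁ (proj₂ (proj₂ (∈A⁻ (φ∈ e e∈))))))
        (trans eq (proj₁ (proj₂ (proj₂ (∈A⁻ (φ∈ e′ e′∈))))))))

    -- Elements of B between j and j′ are matched to distinct classes with
    -- representatives in [lo j , hi j′).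
    window : ∀ {j j′} → j ≤ j′ → lo j + count< B j′ ≤ hi j′ + count< B j
    window {j} {j′} j≤j′ = begin
      lo j + count< B j′
        ≤⟨ +-monoʳ-≤ (lo j) (count<-window B S (λ e p q → ∈⟦⟧⁺ S? (p , q))) ⟩
      lo j + (count< B j + ∣ B ∩ S ∣)    ≡⟨ swap (lo j) (count< B j) _ ⟩
      lo j + ∣ B ∩ S ∣ + count< B j      ≤⟨ +-monoˡ-≤ (count< B j) (injection-into-interval (B ∩ S)
                                        (≤-trans (lo-mono j≤j′) (lo≤hi j′))
                                        (λ e e∈ → v e (∈B e∈))
                                        (λ e e∈ → ≤-trans (lo-mono (proj₁ (∈S e∈))) (v-lb e _))
                                        (λ e e∈ → <-≤-trans (v-ub e _) (hi-mono (proj₂ (∈S e∈))))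
                                        (λ e e′ _ _ eq → v-inj e e′ _ _ (cong (_% r) eq))) ⟩
      hi j′ + count< B j                 ∎
      where
      swap : ∀ a b c → a + (b + c) ≡ a + c + b
      swap = solve-∀
      S? : ∀ (e : Fin n) → Dec (j ≤ toℕ e × toℕ e < j′)
      S? e = (j ≤? toℕ e) ×-dec (toℕ e <? j′)
      S = ⟦ S? ⟧
      ∈B : ∀ {e} → e ∈ B ∩ S → e ∈ B
      ∈B e∈ = proj₁ (x∈p∩q⁻ B S e∈)
      ∈S : ∀ {e} → e ∈ B ∩ S → j ≤ toℕ e × toℕ e < j′
      ∈S e∈ = ∈⟦⟧⁻ S? (proj₂ (x∈p∩q⁻ B S e∈))

    -- The same count for the cyclic window from j around to j′.
    cowindow : ∀ {j j′} → j ≤ n → j′ ≤ j → lo j + count< B j′ ≤ hi j′ + count< B j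
    -- Adding `r` to both sides lets it stand for `∣ B ∣` on the left and for the rise over one
    -- period on the right.
    cowindow {j} {j′} j≤n j′≤j = +-cancelʳ-≤ r _ _ (begin
      lo j + count< B j′ + r             ≡⟨ swap₁ (lo j) (count< B j′) r ⟩
      lo j + (r + count< B j′)           ≡⟨ cong (λ s → lo j + (s + count< B j′)) ∣B∣≡r ⟨
      lo j + (∣ B ∣ + count< B j′)
        ≤⟨ +-monoʳ-≤ (lo j) (count<-cowindow B S j′≤j (λ e p → ∈⟦⟧⁺ S? p)) ⟩
      lo j + (∣ B ∩ S ∣ + count< B j)    ≡⟨ +-assoc (lo j) _ _ ⟨
      lo j + ∣ B ∩ S ∣ + count< B j      ≤⟨ +-monoˡ-≤ (count< B j) (injection-into-interval (B ∩ S)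
                                        (≤-trans lo-j≤r (m≤n+m r _))
                                        (λ e e∈ → w e (∈B e∈) (∈S e∈))
                                        (λ e e∈ → w-lb e (∈B e∈) (∈S e∈))
                                        (λ e e∈ → w-ub e (∈B e∈) (∈S e∈))
                                        (λ e e′ e∈ e′∈ eq → v-inj e e′ _ _
                                          (trans (sym (w-% e (∈B e∈) (∈S e∈)))
                                            (trans (cong (_% r) eq) (w-% e′ (∈B e′∈) (∈S e′∈)))))) ⟩
      hi j′ + r + count< B j             ≡⟨ swap₂ (hi j′) r (count< B j) ⟩
      hi j′ + count< B j + r             ∎)
      where
      swap₁ : ∀ a b c → a + b + c ≡ a + (c + b)
      swap₁ = solve-∀
      swap₂ : ∀ a b c → a + b + c ≡ a + c + b
      swap₂ = solve-∀
      S? : ∀ (e : Fin n) → Dec (toℕ e < j′ ⊎ j ≤ toℕ e)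
      S? e = (toℕ e <? j′) ⊎-dec (j ≤? toℕ e)
      S = ⟦ S? ⟧
      ∈B : ∀ {e} → e ∈ B ∩ S → e ∈ B
      ∈B e∈ = proj₁ (x∈p∩q⁻ B S e∈)
      ∈S : ∀ {e} → e ∈ B ∩ S → toℕ e < j′ ⊎ j ≤ toℕ e
      ∈S e∈ = ∈⟦⟧⁻ S? (proj₂ (x∈p∩q⁻ B S e∈))
      lo-j≤r : lo j ≤ r
      lo-j≤r = ≤-trans (lo-mono j≤n) (≤-reflexive lo-n)

      -- Elements before `j′` are reached only after wrapping around, one period later, so their
      -- heights are raised by `r`; residues are unchanged.
      w : ∀ e → e ∈ B → toℕ e < j′ ⊎ j ≤ toℕ e → ℕ
      w e e∈ (inj₁ _) = v e e∈ + r
      w e e∈ (inj₂ _) = v e e∈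

      w-lb : ∀ e e∈ p → lo j ≤ w e e∈ p
      w-lb e e∈ (inj₁ _)   = ≤-trans lo-j≤r (m≤n+m r _)
      w-lb e e∈ (inj₂ j≤e) = ≤-trans (lo-mono j≤e) (v-lb e e∈)

      w-ub : ∀ e e∈ p → w e e∈ p < hi j′ + r
      w-ub e e∈ (inj₁ e<j′) = +-monoˡ-< r (<-≤-trans (v-ub e e∈) (hi-mono e<j′))
      w-ub e e∈ (inj₂ _)    = begin-strict
        v e e∈         <⟨ v-ub e e∈ ⟩
        hi (suc (toℕ e)) ≤⟨ hi-mono (toℕ<n e) ⟩
        hi (0 + n)     ≡⟨ hi-period 0 ⟩
        hi 0 + r       ≤⟨ +-monoˡ-≤ r (hi-mono z≤n) ⟩
        hi j′ + r      ∎

      w-% : ∀ e e∈ p → w e e∈ p % r ≡ v e e∈ % r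
      w-% e e∈ (inj₁ _) = [m+n]%n≡m%n (v e e∈) r
      w-% e e∈ (inj₂ _) = refl

    within : ∀ j → j ≤ n → a + count< B j ≤ hi j
    -- Replacing `a + count< B i` by `lo i` turns the bound into the window inequality for `i` and
    -- `j`, direct or cyclic according to their order.
    within j j≤n = +-cancelʳ-≤ (count< B i) _ _ (begin
      a + count< B j + count< B i  ≡⟨ swap a (count< B j) (count< B i) ⟩
      a + count< B i + count< B j  ≡⟨ cong (_+ count< B j) lo-i ⟨
      lo i + count< B j       ≤⟨ either (≤-total i j) ⟩
      hi j + count< B i       ∎)
      where
      swap : ∀ a b c → a + b + c ≡ a + c + b
      swap = solve-∀
      either : i ≤ j ⊎ j ≤ i → lo i + count< B j ≤ hi j + count< B i
      either (inj₁ i≤j) = window i≤j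
      either (inj₂ j≤i) = cowindow i≤n j≤i

  -- Each element is matched to the class of the height from which the path rises. These are `r`
  -- consecutive heights, hence distinct modulo `r`; maximality holds because no partial transversal
  -- has more than `r` elements.
  fits⇒basis : ∀ {B} → Fits r lo hi B → IsTransversalBasis A B
  fits⇒basis {B} (∣B∣≡r , a , fit) = (φ , φ∈ , φ-inj) , maximal
    where
    φ : ∀ e → e ∈ B → Fin r
    φ e _ = (a + count< B (toℕ e)) mod r

    toℕ-φ : ∀ e e∈ → toℕ (φ e e∈) ≡ (a + count< B (toℕ e)) % r
    toℕ-φ e e∈ = toℕ-fromℕ< _

    φ∈ : ∀ e e∈ → e ∈ A (φ e e∈)
    φ∈ e e∈ = ∈A⁺ (a + count< B (toℕ e) ,
      (begin
        suc (a + count< B (toℕ e))      ≡⟨ +-suc a _ ⟨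
        a + suc (count< B (toℕ e))      ≡⟨ cong (a +_) (count<-∈ e∈) ⟨
        a + count< B (suc (toℕ e))      ≤⟨ proj₂ (fit (suc (toℕ e)) (toℕ<n e)) ⟩
        hi (suc (toℕ e))           ∎) ,
      sym (toℕ-φ e e∈) , proj₁ (fit (toℕ e) (<⇒≤ (toℕ<n e))))
      where open ≤-Reasoning

    earlier : ∀ e e′ → e ∈ B → e′ ∈ B → toℕ e < toℕ e′ →
      (a + count< B (toℕ e)) % r ≢ (a + count< B (toℕ e′)) % r
    earlier e e′ e∈ e′∈ e<e′ = residue-gap r
      (+-monoʳ-< a (≤-trans (≤-reflexive (sym (count<-∈ e∈))) (monotone {count< B} (count<-up B) e<e′)))
      (begin-strict
        a + count< B (toℕ e′)
          <⟨ +-monoʳ-< a (≤-trans (≤-reflexive (sym (count<-∈ e′∈))) (count<≤∣∣ B _)) ⟩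
        a + ∣ B ∣             ≡⟨ cong (a +_) ∣B∣≡r ⟩
        a + r                 ≤⟨ +-monoˡ-≤ r (m≤m+n a _) ⟩
        a + count< B (toℕ e) + r   ∎)
      where open ≤-Reasoning

    φ-inj : ∀ e e′ e∈ e′∈ → φ e e∈ ≡ φ e′ e′∈ → e ≡ e′
    φ-inj e e′ e∈ e′∈ eq with <-cmp (toℕ e) (toℕ e′)
    ... | tri≈ _ p _ = toℕ-injective p
    ... | tri< p _ _ = contradiction
          (trans (sym (toℕ-φ e e∈)) (trans (cong toℕ eq) (toℕ-φ e′ e′∈))) (earlier e e′ e∈ e′∈ p)
    ... | tri> _ _ p = contradiction
          (trans (sym (toℕ-φ e′ e′∈)) (trans (cong toℕ (sym eq)) (toℕ-φ e e∈))) (earlier e′ e e′∈ e∈ p)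

    maximal : ∀ B′ → B ⊆ B′ → PartialTransversal A B′ → B′ ⊆ B
    maximal B′ B⊆B′ T {x} x∈ with x ∈? B
    ... | yes x∈B = x∈B
    ... | no  x∉B = contradiction
          (≤-trans (transversal-size {A = A} T) (≤-reflexive (sym ∣B∣≡r)))
          (<⇒≱ (p⊂q⇒∣p∣<∣q∣ (B⊆B′ , x , x∈ , x∉B)))

  fits⇔basis : ∀ B → Fits r lo hi B ⇔ IsTransversalBasis A B
  fits⇔basis B =
    mk⇔ fits⇒basis (λ basis → transversal⇒fits (rows-basis-size basis) (proj₁ basis))

-- The rotation of the ground set

[m%n+o]%n≡[m+o]%n : ∀ m o n .{{_ : NonZero n}} → (m % n + o) % n ≡ (m + o) % n
[m%n+o]%n≡[m+o]%n m o n = begin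
  (m % n + o) % n            ≡⟨ %-distribˡ-+ (m % n) o n ⟩
  (m % n % n + o % n) % n    ≡⟨ cong (λ k → (k + o % n) % n) (m%n%n≡m%n m n) ⟩
  (m % n + o % n) % n        ≡⟨ %-distribˡ-+ m o n ⟨
  (m + o) % n                ∎
  where open ≡-Reasoning

shiftBy : ∀ {n} .{{_ : NonZero n}} → ℕ → Fin n → Fin n
shiftBy {n} k e = (toℕ e + k) mod n

toℕ-mod : ∀ x n .{{_ : NonZero n}} → toℕ (x mod n) ≡ x % n
toℕ-mod x n = toℕ-fromℕ< _

shiftBy-inverse : ∀ {n} .{{_ : NonZero n}} j k → j + k ≡ n → (e : Fin n) → shiftBy j (shiftBy k e) ≡ e
shiftBy-inverse {n} j k j+k≡n e = toℕ-injective (begin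
  toℕ (shiftBy j (shiftBy k e))   ≡⟨ toℕ-mod (toℕ (shiftBy k e) + j) n ⟩
  (toℕ (shiftBy k e) + j) % n     ≡⟨ cong (λ x → (x + j) % n) (toℕ-mod (toℕ e + k) n) ⟩
  ((toℕ e + k) % n + j) % n       ≡⟨ [m%n+o]%n≡[m+o]%n (toℕ e + k) j n ⟩
  (toℕ e + k + j) % n
    ≡⟨ cong (_% n) (trans (+-assoc (toℕ e) k j) (cong (toℕ e +_) (trans (+-comm k j) j+k≡n))) ⟩
  (toℕ e + n) % n                 ≡⟨ [m+n]%n≡m%n (toℕ e) n ⟩
  toℕ e % n                       ≡⟨ m<n⇒m%n≡m (toℕ<n e) ⟩
  toℕ e                           ∎)
  where open ≡-Reasoning

rotation : ∀ n → Permutation′ n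
rotation zero    = idₚ
rotation (suc n) = permutation (shiftBy 1) (shiftBy n)
  (shiftBy-inverse 1 n refl) (shiftBy-inverse n 1 (+-comm n 1))

iter-rotation : ∀ {n} .{{_ : NonZero n}} j (e : Fin n) → toℕ (iter (rotation n) j e) ≡ (toℕ e + j) % n
iter-rotation {suc n} zero e =
  sym (trans (cong (_% suc n) (+-identityʳ (toℕ e))) (m<n⇒m%n≡m (toℕ<n e)))
iter-rotation {suc n} (suc j) e = begin
  toℕ (shiftBy 1 (iter (rotation (suc n)) j e))
    ≡⟨ toℕ-mod (toℕ (iter (rotation (suc n)) j e) + 1) (suc n) ⟩
  (toℕ (iter (rotation (suc n)) j e) + 1) % suc n ≡⟨ cong (λ x → (x + 1) % suc n) (iter-rotation j e) ⟩
  ((toℕ e + j) % suc n + 1) % suc n              ≡⟨ [m%n+o]%n≡[m+o]%n (toℕ e + j) 1 (suc n) ⟩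
  (toℕ e + j + 1) % suc n                        ≡⟨ cong (_% suc n) (swap (toℕ e) j) ⟩
  (toℕ e + suc j) % suc n                        ∎
  where
  open ≡-Reasoning
  swap : ∀ a b → a + b + 1 ≡ a + suc b
  swap = solve-∀

rotation-cyclic : ∀ n → IsCyclic (rotation n)
-- The exponent is `b - a` plus a full turn, which keeps it a natural number.
rotation-cyclic (suc n) a b = toℕ b + (suc n ∸ toℕ a) , toℕ-injective (begin
  toℕ (iter (rotation (suc n)) (toℕ b + (suc n ∸ toℕ a)) a)  ≡⟨ iter-rotation (toℕ b + (suc n ∸ toℕ a)) a ⟩
  (toℕ a + (toℕ b + (suc n ∸ toℕ a))) % suc n                ≡⟨ cong (_% suc n) (swap (toℕ a) (toℕ b) _) ⟩
  (toℕ b + (toℕ a + (suc n ∸ toℕ a))) % suc n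
    ≡⟨ cong (λ x → (toℕ b + x) % suc n) (m+[n∸m]≡n (<⇒≤ (toℕ<n a))) ⟩
  (toℕ b + suc n) % suc n                                    ≡⟨ [m+n]%n≡m%n (toℕ b) (suc n) ⟩
  toℕ b % suc n                                              ≡⟨ m<n⇒m%n≡m (toℕ<n b) ⟩
  toℕ b                                                      ∎)
  where
  open ≡-Reasoning
  swap : ∀ a b c → a + (b + c) ≡ b + (a + c)
  swap = solve-∀

-- The rows are cyclic intervals forming an antichain

periods : ∀ {f : ℕ → ℕ} {n r} → (∀ x → f (x + n) ≡ f x + r) → ∀ x c → f (x + c * n) ≡ f x + c * r
periods {f} period x zero    = trans (cong f (+-identityʳ x)) (sym (+-identityʳ (f x)))
periods {f} {n} {r} period x (suc c) = begin
  f (x + (n + c * n))   ≡⟨ cong f (swap x n (c * n)) ⟩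
  f (x + c * n + n)     ≡⟨ period (x + c * n) ⟩
  f (x + c * n) + r     ≡⟨ cong (_+ r) (periods {f} period x c) ⟩
  f x + c * r + r       ≡⟨ swap (f x) r (c * r) ⟨
  f x + (r + c * r)     ∎
  where
  open ≡-Reasoning
  swap : ∀ a b c → a + (b + c) ≡ a + c + b
  swap = solve-∀

module Intervals {n r lo hi} .{{_ : NonZero n}} .{{_ : NonZero r}} (strip : Strip n r lo hi) where
  open Strip strip

  private
    A : Fin r → Subset n
    A = rows r lo hi

    -- The unrolled form of `MeetsClass`: some path in the strip can rise at position `x` from
    -- height `w`.
    Admits : ℕ → ℕ → Set
    Admits x w = lo x ≤ w × w < hi (suc x)

    lo-wrap : ∀ x → lo x ≡ lo (x % n) + x / n * r
    lo-wrap x = trans (cong lo (m≡m%n+[m/n]*n x n)) (periods {lo} lo-period (x % n) (x / n))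

    hi-wrap : ∀ x → hi (suc x) ≡ hi (suc (x % n)) + x / n * r
    hi-wrap x = trans (cong (λ y → hi (suc y)) (m≡m%n+[m/n]*n x n))
                  (periods {hi} hi-period (suc (x % n)) (x / n))

    -- Going back by the `x / n` full turns lowers the height by a multiple of `r`, so the residue
    -- class is kept. The converse `∈⇒admits` goes forward by the same turns.
    admits⇒∈ : ∀ {x w t} → Admits x w → w % r ≡ toℕ t → x mod n ∈ A t
    admits⇒∈ {x} {w} {t} (lo≤ , <hi) w%r = ∈⟦⟧⁺ (meetsClass? r lo hi t)
      ( w ∸ x / n * r
      , subst (λ y → w ∸ x / n * r < hi (suc y)) (sym (toℕ-mod x n))
          (+-cancelʳ-< (x / n * r) _ _ (begin-strict
            w ∸ x / n * r + x / n * r    ≡⟨ m∸n+n≡m c≤w ⟩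
            w                            <⟨ <hi ⟩
            hi (suc x)                   ≡⟨ hi-wrap x ⟩
            hi (suc (x % n)) + x / n * r ∎))
      , trans (m*n≤o⇒[o∸m*n]%n≡o%n (x / n) c≤w) w%r
      , subst (λ y → lo y ≤ w ∸ x / n * r) (sym (toℕ-mod x n))
          (m+n≤o⇒m≤o∸n _ (≤-trans (≤-reflexive (sym (lo-wrap x))) lo≤)))
      where
      open ≤-Reasoning
      c≤w : x / n * r ≤ w
      c≤w = ≤-trans (m≤n+m _ _) (≤-trans (≤-reflexive (sym (lo-wrap x))) lo≤)

    ∈⇒admits : ∀ {x t} → x mod n ∈ A t → ∃ λ w → w % r ≡ toℕ t × Admits x w
    ∈⇒admits {x} {t} x∈ with ∈⟦⟧⁻ (meetsClass? r lo hi t) x∈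
    ... | v , v<hi , v%r , lo≤v =
      v + x / n * r , trans ([m+kn]%n≡m%n v (x / n) r) v%r ,
      ≤-trans (≤-reflexive (trans (lo-wrap x) (cong (λ y → lo y + x / n * r) (sym (toℕ-mod x n)))))
        (+-monoˡ-≤ _ lo≤v) ,
      <-≤-trans (+-monoˡ-< _ v<hi)
        (≤-reflexive (sym (trans (hi-wrap x) (cong (λ y → hi (suc y) + x / n * r) (sym (toℕ-mod x n))))))

    lo-crossing : ∀ w → ∃ λ x → lo x ≤ w × w < lo (suc x)
    lo-crossing w =
      -- Each turn raises `lo` by `r ≥ 1`, so `suc w` turns bring it above `w`.
      let x , _ , p = crossing lo (suc w * n) (≤-trans (≤-reflexive lo-zero) z≤n) big in x , p
      where
      big : w < lo (suc w * n)
      big = begin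
        suc w             ≤⟨ m≤m*n (suc w) r ⟩
        suc w * r         ≤⟨ m≤n+m _ (lo 0) ⟩
        lo 0 + suc w * r  ≡⟨ periods {lo} lo-period 0 (suc w) ⟨
        lo (suc w * n)    ∎
        where open ≤-Reasoning

    hi-crossing : ∀ {w} → hi 0 ≤ w → ∃ λ x → hi x ≤ w × w < hi (suc x)
    hi-crossing {w} hi0≤ =
      let y , _ , w<lo = lo-crossing w
          x , _ , p = crossing hi (suc y) hi0≤ (<-≤-trans w<lo (lo≤hi (suc y)))
      in x , p

  -- For a single lift `w` of the class, the positions admitting it run exactly from the crossing
  -- `q` of `hi` to the crossing `p` of `lo`. Any other representative is carried to `w` by whole
  -- turns, which fix positions modulo `n`.
  rows-interval : ∀ t → IsσInterval (rotation n) (A t)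
  rows-interval t with hi-crossing hi0≤w | lo-crossing w
    where
    -- Heights occurring in `MeetsClass` are below `hi n = hi 0 + r`, so this many periods put `w`
    -- at or above each of those in the class, and also above `hi 0` as `hi-crossing` requires.
    w = toℕ t + (hi 0 + r) * r
    hi0≤w : hi 0 ≤ w
    hi0≤w = ≤-trans (m≤m+n (hi 0) r) (≤-trans (m≤m*n (hi 0 + r) r) (m≤n+m _ (toℕ t)))
  ... | q , hi-q≤w , w<hi-q | p , lo-p≤w , w<lo-p =
    q mod n , p ∸ q , λ e → mk⇔ (to e) (from e)
    where
    open ≤-Reasoning
    d = hi 0 + r
    w = toℕ t + d * r

    iterate : ∀ j → toℕ (iter (rotation n) j (q mod n)) ≡ (q + j) % n
    iterate j = trans (iter-rotation j (q mod n))
      (trans (cong (λ y → (y + j) % n) (toℕ-mod q n)) ([m%n+o]%n≡[m+o]%n q j n))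

    q≤p : q ≤ p
    q≤p = ≮⇒≥ λ p<q → <⇒≱ w<lo-p (≤-trans (lo-mono p<q) (≤-trans (lo≤hi q) hi-q≤w))

    from : ∀ e → (∃ λ j → j ≤ p ∸ q × iter (rotation n) j (q mod n) ≡ e) → e ∈ A t
    from e (j , j≤ , eq) = subst (_∈ A t) (trans x≡ eq) (admits⇒∈ {q + j} {w}
      ( ≤-trans (lo-mono (≤-trans (+-monoʳ-≤ q j≤) (≤-reflexive (m+[n∸m]≡n q≤p)))) lo-p≤w
      , <-≤-trans w<hi-q (hi-mono (s≤s (m≤m+n q j))))
      (trans ([m+kn]%n≡m%n (toℕ t) d r) (m<n⇒m%n≡m (toℕ<n t))))
      where
      x≡ : (q + j) mod n ≡ iter (rotation n) j (q mod n)
      x≡ = toℕ-injective (trans (toℕ-mod (q + j) n) (sym (iterate j)))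

    to : ∀ e → e ∈ A t → ∃ λ j → j ≤ p ∸ q × iter (rotation n) j (q mod n) ≡ e
    to e e∈ with ∈⟦⟧⁻ (meetsClass? r lo hi t) e∈
    ... | v , v<hi , v%r , lo≤v = x ∸ q , ∸-monoˡ-≤ q x≤p , toℕ-injective (begin-equality
        toℕ (iter (rotation n) (x ∸ q) (q mod n))  ≡⟨ iterate (x ∸ q) ⟩
        (q + (x ∸ q)) % n                          ≡⟨ cong (_% n) (m+[n∸m]≡n q≤x) ⟩
        x % n                                      ≡⟨ [m+kn]%n≡m%n (toℕ e) (d ∸ c) n ⟩
        toℕ e % n                                  ≡⟨ m<n⇒m%n≡m (toℕ<n e) ⟩
        toℕ e                                      ∎)
      where
      c = v / r
      -- The position of `e`, moved by as many turns as lift `v` to `w`.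
      x = toℕ e + (d ∸ c) * n

      c≤d : c ≤ d
      c≤d = begin
        c                      ≤⟨ m/n≤m v r ⟩
        v                      ≤⟨ <⇒≤ v<hi ⟩
        hi (suc (toℕ e))       ≤⟨ hi-mono (toℕ<n e) ⟩
        hi n                   ≡⟨ hi-period 0 ⟩
        hi 0 + r               ∎

      w≡ : w ≡ v + (d ∸ c) * r
      w≡ = begin-equality
        toℕ t + d * r                     ≡⟨ cong (λ y → toℕ t + y * r) (m+[n∸m]≡n c≤d) ⟨
        toℕ t + (c + (d ∸ c)) * r         ≡⟨ distrib (toℕ t) c (d ∸ c) r ⟩
        toℕ t + c * r + (d ∸ c) * r       ≡⟨ cong (λ y → y + c * r + (d ∸ c) * r) v%r ⟨
        v % r + c * r + (d ∸ c) * r       ≡⟨ cong (_+ (d ∸ c) * r) (m≡m%n+[m/n]*n v r) ⟨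
        v + (d ∸ c) * r                   ∎
        where
        distrib : ∀ t a b r → t + (a + b) * r ≡ t + a * r + b * r
        distrib = solve-∀

      q≤x : q ≤ x
      q≤x = ≮⇒≥ λ x<q → <⇒≱ w<hi (≤-trans (hi-mono x<q) hi-q≤w)
        where
        w<hi : w < hi (suc x)
        w<hi = begin-strict
          w                                 ≡⟨ w≡ ⟩
          v + (d ∸ c) * r                   <⟨ +-monoˡ-< _ v<hi ⟩
          hi (suc (toℕ e)) + (d ∸ c) * r    ≡⟨ periods {hi} hi-period (suc (toℕ e)) (d ∸ c) ⟨
          hi (suc x)                        ∎

      x≤p : x ≤ p
      x≤p = ≮⇒≥ λ p<x → <⇒≱ w<lo-p (≤-trans (lo-mono p<x) lo≤w)
        where
        lo≤w : lo x ≤ w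
        lo≤w = begin
          lo x                              ≡⟨ periods {lo} lo-period (toℕ e) (d ∸ c) ⟩
          lo (toℕ e) + (d ∸ c) * r          ≤⟨ +-monoˡ-≤ _ lo≤v ⟩
          v + (d ∸ c) * r                   ≡⟨ w≡ ⟨
          w                                 ∎

  -- If row t lifts to a height t strictly between s and s + r, its interval starts before the
  -- next lift of row s starts and ends after that of s ends, so it contains a point of the gap.
  private
    gap-point : (∀ x → hi (2 + x) ≤ lo x + r) → ∀ {s t} → hi 0 ≤ t → s < t → t < s + r →
      ∃ λ x → Admits x t × s < lo x × hi (suc x) ≤ s + r
    gap-point narrow {s} {t} hi0≤t s<t t<s+r with lo-crossing s | hi-crossing hi0≤t
    ... | p , lo-p≤s , s<lo | q , hi-q≤t , t<hi with q ≤? suc p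
    -- The first position past the interval of `s`. This is where narrowness enters: it puts that
    -- position before the interval of `s + r`.
    ...   | yes q≤ = suc p ,
            (≤-trans (lo-step p) (≤-trans (s≤s lo-p≤s) s<t) , <-≤-trans t<hi (hi-mono (s≤s q≤))) ,
            s<lo , ≤-trans (narrow p) (+-monoˡ-≤ r lo-p≤s)
    ...   | no q≰ = q ,
            (≤-trans (lo≤hi q) hi-q≤t , t<hi) ,
            <-≤-trans s<lo (lo-mono (<⇒≤ (≰⇒> q≰))) , ≤-trans (hi-step q) (≤-trans (s≤s hi-q≤t) t<s+r)

    -- Lifts of distinct residues alternate: the wanted lift of `i` is in the same period as that of
    -- `j` if `j < i`, and in the next one if `i < j`.
    lift-between : ∀ (i j : Fin r) → i ≢ j → ∀ d →
      ∃ λ c → d ≤ c × toℕ j + d * r < toℕ i + c * r × toℕ i + c * r < toℕ j + d * r + r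
    lift-between i j i≢j d with <-cmp (toℕ i) (toℕ j)
    ... | tri≈ _ p _ = contradiction (toℕ-injective p) i≢j
    ... | tri> _ _ j<i = d , ≤-refl , +-monoˡ-< _ j<i , (begin-strict
        toℕ i + d * r      <⟨ +-monoˡ-< (d * r) (toℕ<n i) ⟩
        r + d * r          ≤⟨ m≤n+m _ (toℕ j) ⟩
        toℕ j + (r + d * r) ≡⟨ swap (toℕ j) r (d * r) ⟩
        toℕ j + d * r + r  ∎)
      where
      open ≤-Reasoning
      swap : ∀ a b c → a + (b + c) ≡ a + c + b
      swap = solve-∀
    ... | tri< i<j _ _ = suc d , n≤1+n d ,
        <-≤-trans (+-monoˡ-< (d * r) (toℕ<n j)) (m≤n+m _ (toℕ i)) ,
        <-≤-trans (+-monoˡ-< (r + d * r) i<j) (≤-reflexive (swap (toℕ j) r (d * r)))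
      where
      swap : ∀ a b c → a + (b + c) ≡ a + c + b
      swap = solve-∀

  -- If the gap point belonged to row `j`, it would admit a height congruent to `s` strictly between
  -- `s` and `s + r`.
  rows-antichain : (∀ x → hi (2 + x) ≤ lo x + r) → IsAntichain A
  rows-antichain narrow i j i≢j Ai⊆Aj =
    let c , d≤c , s<t , t<s+r = lift-between i j i≢j (hi 0)
        t = toℕ i + c * r
        s = toℕ j + hi 0 * r
        hi0≤t = ≤-trans d≤c (≤-trans (m≤m*n c r) (m≤n+m _ (toℕ i)))
        x , admits , s<lo , hi≤ = gap-point narrow hi0≤t s<t t<s+r
        w , w%r , lo≤w , w<hi = ∈⇒admits {x} (Ai⊆Aj (admits⇒∈ {x} {t} admits (lift-% i c)))
    in residue-gap r (<-≤-trans s<lo lo≤w) (<-≤-trans w<hi hi≤) (trans (lift-% j (hi 0)) (sym w%r))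
    where
    lift-% : ∀ (k : Fin r) c → (toℕ k + c * r) % r ≡ toℕ k
    lift-% k c = trans ([m+kn]%n≡m%n (toℕ k) c r) (m<n⇒m%n≡m (toℕ<n k))

  strip-multiPath : IsAntichain A → IsMultiPathBases (Fits r lo hi)
  strip-multiPath antichain =
    rotation n , rotation-cyclic n , r , A , rows-interval , antichain , fits⇔basis strip

multiPath-resp-⇔ : ∀ {n} {𝓑 𝓑′ : Subset n → Set} →
  (∀ B → 𝓑 B ⇔ 𝓑′ B) → IsMultiPathBases 𝓑′ → IsMultiPathBases 𝓑
multiPath-resp-⇔ eqv (σ , cyclic , c , A , intervals , antichain , bases) =
  σ , cyclic , c , A , intervals , antichain , λ B → ⇔-trans (eqv B) (bases B)

-- Capping the upper boundary

-- A path meeting the lower boundary automatically stays below cap, so capping loses no label-set.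
-- With period 2 + n, lo (x + n) stands for lo (x − 2) + r.
module Cap {n r lo hi} (strip : Strip (2 + n) r lo hi) (2≤r : 2 ≤ r) where
  open Strip strip
  open ≤-Reasoning

  cap : ℕ → ℕ
  cap x = hi x ⊓ lo (x + n)

  capped-strip : Strip (2 + n) r lo cap
  capped-strip = record
    { lo-zero   = lo-zero
    ; lo-period = lo-period
    ; hi-period = λ x → trans
        (cong₂ _⊓_ (hi-period x) (trans (cong lo (swap x (2 + n) n)) (lo-period (x + n))))
        (sym (+-distribʳ-⊓ r (hi x) (lo (x + n))))
    ; lo-up     = lo-up
    ; hi-up     = λ x → ⊓-mono-≤ (hi-up x) (lo-up (x + n))
    ; lo-step   = lo-step
    ; hi-step   = λ x → ⊓-mono-≤ (hi-step x) (lo-step (x + n))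
    ; lo≤hi     = λ x → ⊓-glb (lo≤hi x) (lo-mono (m≤m+n x n))
    }
    where
    swap : ∀ a b c → a + b + c ≡ a + c + b
    swap = solve-∀

  capped-narrow : ∀ x → cap (2 + x) ≤ lo x + r
  capped-narrow x = begin
    cap (2 + x)      ≤⟨ m⊓n≤n (hi (2 + x)) _ ⟩
    lo (2 + x + n)   ≡⟨ cong lo (swap x n) ⟩
    lo (x + (2 + n)) ≡⟨ lo-period x ⟩
    lo x + r         ∎
    where
    swap : ∀ a b → 2 + a + b ≡ a + (2 + b)
    swap = solve-∀

  -- The path touches `lo` at `i`. From `i + 2` on, the cap has already reached `lo i + r`, and the
  -- path never exceeds `a + r`. At `i`, and before it as long as `i ≤ j + n`, monotonicity
  -- suffices. The cases `j = i + 1` and `j = 0`, `i = n + 1` remain, and use `2 ≤ r`.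
  below-cap : ∀ (B : Subset (2 + n)) → ∣ B ∣ ≡ r → ∀ {a i} → i ≤ suc n → lo i ≡ a + count< B i →
    ∀ j → a + count< B j ≤ lo (j + n)
  below-cap B ∣B∣≡r {a} {i} i≤1+n lo-i j with i ≤? j
  ... | yes i≤j with m≤n⇒∃[o]m+o≡n i≤j
  ...   | zero , refl = begin
          a + count< B (i + 0)     ≡⟨ cong (λ y → a + count< B y) (+-identityʳ i) ⟩
          a + count< B i           ≡⟨ lo-i ⟨
          lo i                ≤⟨ lo-mono (≤-trans (m≤m+n i 0) (m≤m+n (i + 0) n)) ⟩
          lo (i + 0 + n)      ∎
  -- The path gains at most 1 after `i`, while the cap is at most 1 short of `lo i + r`.
  ...   | suc zero , refl = s≤s⁻¹ (begin
          suc (a + count< B (i + 1))        ≡⟨ cong (λ y → suc (a + count< B y)) (+-comm i 1) ⟩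
          suc (a + count< B (suc i))        ≤⟨ s≤s (+-monoʳ-≤ a (count<-step B i)) ⟩
          suc (a + suc (count< B i))        ≡⟨ assoc a (count< B i) ⟩
          a + count< B i + 2                ≤⟨ +-mono-≤ (≤-reflexive (sym lo-i)) 2≤r ⟩
          lo i + r                     ≡⟨ lo-period i ⟨
          lo (i + (2 + n))             ≡⟨ cong lo (swap i n) ⟩
          lo (suc (i + 1 + n))         ≤⟨ lo-step _ ⟩
          suc (lo (i + 1 + n))         ∎)
          where
          assoc : ∀ a b → suc (a + suc b) ≡ a + b + 2
          assoc = solve-∀
          swap : ∀ a b → a + (2 + b) ≡ suc (a + 1 + b)
          swap = solve-∀
  ...   | suc (suc k) , refl = begin
          a + count< B (i + (2 + k))        ≤⟨ +-monoʳ-≤ a (count<≤∣∣ B _) ⟩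
          a + ∣ B ∣                    ≡⟨ cong (a +_) ∣B∣≡r ⟩
          a + r                        ≤⟨ +-monoˡ-≤ r (m≤m+n a (count< B i)) ⟩
          a + count< B i + r                ≡⟨ cong (_+ r) lo-i ⟨
          lo i + r                     ≡⟨ lo-period i ⟨
          lo (i + (2 + n))             ≤⟨ lo-mono (≤-trans (m≤m+n _ k) (≤-reflexive (swap i n k))) ⟩
          lo (i + (2 + k) + n)         ∎
          where
          swap : ∀ a b c → a + (2 + b) + c ≡ a + (2 + c) + b
          swap = solve-∀
  below-cap B ∣B∣≡r {a} {i} i≤1+n lo-i j | no i≰j with i ≤? j + n
  ... | yes i≤j+n = begin
          a + count< B j     ≤⟨ +-monoʳ-≤ a (monotone {count< B} (count<-up B) (<⇒≤ (≰⇒> i≰j))) ⟩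
          a + count< B i     ≡⟨ lo-i ⟨
          lo i          ≤⟨ lo-mono i≤j+n ⟩
          lo (j + n)    ∎
  below-cap B ∣B∣≡r {a} {i} i≤1+n lo-i (suc j) | no i≰j | no i≰j+n =
    contradiction (≤-trans i≤1+n (s≤s (m≤n+m n j))) i≰j+n
  -- Only `i = n + 1` is left. At most one element of `B` comes at the last position, so the path
  -- has risen by then, whereas `lo` rises at most once from `n` to `n + 1`.
  below-cap B ∣B∣≡r {a} {i} i≤1+n lo-i zero | no i≰j | no i≰n with ≤-antisym i≤1+n (≰⇒> i≰n)
  ... | refl = s≤s⁻¹ (begin
          suc (a + count< B 0)        ≡⟨ cong (λ y → suc (a + y)) (count<-zero B) ⟩
          suc (a + 0)            ≡⟨ +-suc a 0 ⟨
          a + 1                  ≤⟨ +-monoʳ-≤ a 1≤count ⟩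
          a + count< B (suc n)        ≡⟨ lo-i ⟨
          lo (suc n)             ≤⟨ lo-step n ⟩
          suc (lo n)             ∎)
    where
    1≤count : 1 ≤ count< B (suc n)
    1≤count = s≤s⁻¹ (begin
      2                   ≤⟨ 2≤r ⟩
      r                   ≡⟨ ∣B∣≡r ⟨
      ∣ B ∣               ≡⟨ count<-all B ⟨
      count< B (2 + n)         ≤⟨ count<-step B (suc n) ⟩
      suc (count< B (suc n))   ∎)

  fits⇔fits-capped : ∀ B → Fits r lo hi B ⇔ Fits r lo cap B
  fits⇔fits-capped B = mk⇔ to from
    where
    from : Fits r lo cap B → Fits r lo hi B
    from (∣B∣≡r , a , fit) = ∣B∣≡r , a , λ j j≤ →
      proj₁ (fit j j≤) , ≤-trans (proj₂ (fit j j≤)) (m⊓n≤m (hi j) _)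

    to : Fits r lo hi B → Fits r lo cap B
    -- Lower the path until it touches `lo`. The search stops at `suc n` because `below-cap` wants a
    -- touching point before the end of the period; at `2 + n` the bound holds since `lo` and the
    -- count both equal `r` there.
    to (∣B∣≡r , a , fit) with least-shift lo (count< B) (trans lo-zero (sym (count<-zero B))) (suc n)
    ... | a′ , (i , i≤ , lo-i) , above = ∣B∣≡r , a′ , λ j j≤ →
          above′ j j≤ ,
          ⊓-glb (≤-trans (+-monoˡ-≤ (count< B j) a′≤a) (proj₂ (fit j j≤))) (below-cap B ∣B∣≡r i≤ lo-i j)
      where
      a′≤a : a′ ≤ a
      a′≤a = +-cancelʳ-≤ (count< B i) a′ a
        (≤-trans (≤-reflexive (sym lo-i)) (proj₁ (fit i (m≤n⇒m≤1+n i≤))))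

      above′ : ∀ j → j ≤ 2 + n → lo j ≤ a′ + count< B j
      above′ j j≤ with m≤n⇒m<n∨m≡n j≤
      ... | inj₁ j< = above j (s≤s⁻¹ j<)
      ... | inj₂ refl = begin
            lo (2 + n)          ≡⟨ lo-n ⟩
            r                   ≡⟨ ∣B∣≡r ⟨
            ∣ B ∣               ≡⟨ count<-all B ⟨
            count< B (2 + n)         ≤⟨ m≤n+m _ a′ ⟩
            a′ + count< B (2 + n)    ∎

-- Periodic extension of the boundary heights

module Periodic (n r : ℕ) .{{_ : NonZero n}} (f : ℕ → ℕ) (f-n : f n ≡ f 0 + r) where
  ext : ℕ → ℕ
  ext x = f (x % n) + x / n * r

  private
    ext-below : ∀ {i} → i < n → ∀ c → ext (i + c * n) ≡ f i + c * r
    ext-below {i} i<n c = cong₂ (λ x y → f x + y * r)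
      (trans ([m+kn]%n≡m%n i c n) (m<n⇒m%n≡m i<n))
      (trans (+-distrib-/-∣ʳ i (n∣m*n c)) (cong₂ _+_ (m<n⇒m/n≡0 i<n) (m*n/n≡m c n)))

    -- Includes the seam `i = n`, whose value belongs to the next period; `f-n` makes the two
    -- descriptions agree.
    ext-at : ∀ {i} → i ≤ n → ∀ c → ext (i + c * n) ≡ f i + c * r
    ext-at {i} i≤n c with m≤n⇒m<n∨m≡n i≤n
    ... | inj₁ i<n = ext-below i<n c
    ... | inj₂ refl = begin
      ext (suc c * n)       ≡⟨ ext-below {0} (>-nonZero⁻¹ n) (suc c) ⟩
      f 0 + (r + c * r)     ≡⟨ +-assoc (f 0) r (c * r) ⟨
      f 0 + r + c * r       ≡⟨ cong (_+ c * r) f-n ⟨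
      f n + c * r           ∎
      where open ≡-Reasoning

    ext-suc : ∀ x → ext (suc x) ≡ f (suc (x % n)) + x / n * r
    ext-suc x = trans (cong (λ y → ext (suc y)) (m≡m%n+[m/n]*n x n)) (ext-at (m%n<n x n) (x / n))

  ext-≡ : ∀ {i} → i ≤ n → ext i ≡ f i
  ext-≡ {i} i≤n = trans (cong ext (sym (+-identityʳ i))) (trans (ext-at i≤n 0) (+-identityʳ (f i)))

  ext-period : ∀ x → ext (x + n) ≡ ext x + r
  ext-period x = begin
    f ((x + n) % n) + (x + n) / n * r   ≡⟨ cong₂ (λ y z → f y + z * r) ([m+n]%n≡m%n x n) next-period ⟩
    f (x % n) + (r + x / n * r)         ≡⟨ swap (f (x % n)) r (x / n * r) ⟩
    ext x + r                           ∎
    where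
    open ≡-Reasoning
    next-period : (x + n) / n ≡ suc (x / n)
    next-period = trans (m/n≡1+[m∸n]/n (m≤n+m n x)) (cong (λ y → suc (y / n)) (m+n∸n≡m x n))
    swap : ∀ a b c → a + (b + c) ≡ a + c + b
    swap = solve-∀

  ext-up : (∀ x → f x ≤ f (suc x)) → ∀ x → ext x ≤ ext (suc x)
  ext-up up x = ≤-trans (+-monoˡ-≤ _ (up (x % n))) (≤-reflexive (sym (ext-suc x)))

  ext-step : (∀ x → f (suc x) ≤ suc (f x)) → ∀ x → ext (suc x) ≤ suc (ext x)
  ext-step step x = ≤-trans (≤-reflexive (ext-suc x)) (+-monoˡ-≤ _ (step (x % n)))

-- The finite data from which a `Strip` is unrolled; `f` and `g` will be the heights of `P` and `Q`.
record Heights (n r : ℕ) (f g : ℕ → ℕ) : Set where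
  field
    f-zero : f 0 ≡ 0
    f-n    : f n ≡ r
    g-n    : g n ≡ g 0 + r
    f-up   : ∀ x → f x ≤ f (suc x)
    g-up   : ∀ x → g x ≤ g (suc x)
    f-step : ∀ x → f (suc x) ≤ suc (f x)
    g-step : ∀ x → g (suc x) ≤ suc (g x)
    f≤g    : ∀ x → f x ≤ g x

module _ {n r f g} .{{_ : NonZero n}} (heights : Heights n r f g) where
  open Heights heights
  private
    module F = Periodic n r f (trans f-n (cong (_+ r) (sym f-zero)))
    module G = Periodic n r g g-n

  ext-strip : Strip n r F.ext G.ext
  ext-strip = record
    { lo-zero   = trans (F.ext-≡ z≤n) f-zero
    ; lo-period = F.ext-period
    ; hi-period = G.ext-period
    ; lo-up     = F.ext-up f-up
    ; hi-up     = G.ext-up g-up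
    ; lo-step   = F.ext-step f-step
    ; hi-step   = G.ext-step g-step
    ; lo≤hi     = λ x → +-monoˡ-≤ _ (f≤g (x % n))
    }

  fits⇔fits-ext : ∀ (B : Subset n) → Fits r f g B ⇔ Fits r F.ext G.ext B
  fits⇔fits-ext B = mk⇔
    (λ (∣B∣≡r , a , fit) → ∣B∣≡r , a , λ j j≤n →
      subst (_≤ a + count< B j) (sym (F.ext-≡ j≤n)) (proj₁ (fit j j≤n)) ,
      subst (a + count< B j ≤_) (sym (G.ext-≡ j≤n)) (proj₂ (fit j j≤n)))
    (λ (∣B∣≡r , a , fit) → ∣B∣≡r , a , λ j j≤n →
      subst (_≤ a + count< B j) (F.ext-≡ j≤n) (proj₁ (fit j j≤n)) ,
      subst (a + count< B j ≤_) (G.ext-≡ j≤n) (proj₂ (fit j j≤n)))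

-- For `r = 0` the presentation is empty. For `r = 1` there is a single row, trivially an antichain.
-- For `r ≥ 2` and `n ≥ 2` the capped strip is narrow enough. The remaining cases are void, since
-- `f` cannot climb to `r` in fewer than `r` unit steps.
fits-multiPath : ∀ {n} r {f g} → Heights n r f g → IsMultiPathBases (Fits {n} r f g)
fits-multiPath {n} zero {f} {g} heights =
  rotation n , rotation-cyclic n , 0 , no-rows , (λ ()) , (λ ()) , λ B → mk⇔ (to B) (from B)
  where
  open Heights heights
  open ≤-Reasoning

  no-rows : Fin 0 → Subset n
  no-rows ()

  empty : ∀ B → ∣ B ∣ ≤ 0 → ∀ {x} → x ∈ B → ⊥
  empty B ∣B∣≤0 {x} x∈ = <⇒≱ (x∈p⇒∣p-x∣<∣p∣ x∈) (≤-trans ∣B∣≤0 z≤n)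

  to : ∀ B → Fits 0 f g B → IsTransversalBasis no-rows B
  to B (∣B∣≡0 , _) =
    ( (λ e e∈ → ⊥-elim (empty B (≤-reflexive ∣B∣≡0) e∈))
    , (λ e e∈ → ⊥-elim (empty B (≤-reflexive ∣B∣≡0) e∈))
    , (λ e _ e∈ → ⊥-elim (empty B (≤-reflexive ∣B∣≡0) e∈))) ,
    λ B′ _ T {x} x∈ → ⊥-elim (empty B′ (transversal-size {A = no-rows} T) x∈)

  from : ∀ B → IsTransversalBasis no-rows B → Fits 0 f g B
  from B (T , _) = ∣B∣≡0 , 0 , λ j j≤n →
    ≤-trans (monotone {f} f-up j≤n) (≤-trans (≤-reflexive f-n) z≤n) ,
    ≤-trans (count<≤∣∣ B j) (≤-trans (≤-reflexive ∣B∣≡0) z≤n)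
    where
    ∣B∣≡0 : ∣ B ∣ ≡ 0
    ∣B∣≡0 = n≤0⇒n≡0 (transversal-size {A = no-rows} T)
fits-multiPath {zero} (suc r) heights =
  contradiction (trans (sym f-zero) f-n) λ ()
  where open Heights heights
fits-multiPath {suc n} (suc zero) heights =
  multiPath-resp-⇔ (fits⇔fits-ext heights)
    (strip-multiPath λ { zero zero i≢j → contradiction refl i≢j })
  where open Intervals (ext-strip heights)
fits-multiPath {suc zero} (suc (suc r)) heights =
  contradiction (f-step 0)
    (<⇒≱ (≤-trans (s≤s (s≤s (≤-trans (≤-reflexive f-zero) z≤n))) (≤-reflexive (sym f-n))))
  where open Heights heights
fits-multiPath {suc (suc n)} (suc (suc r)) heights =
  multiPath-resp-⇔ (λ B → ⇔-trans (fits⇔fits-ext heights B) (fits⇔fits-capped B))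
    (strip-multiPath (rows-antichain capped-narrow))
  where
  open Cap (ext-strip heights) (s≤s (s≤s z≤n))
  open Intervals capped-strip

-- Lattice paths and step words

antidiagonal : Point → ℕ
antidiagonal (x , y) = x + y

antidiagonal-move : ∀ q s → antidiagonal (move q s) ≡ suc (antidiagonal q)
antidiagonal-move (x , y) E = refl
antidiagonal-move (x , y) N = +-suc x y

antidiagonal-endpoint : ∀ q ss → antidiagonal (endpoint q ss) ≡ antidiagonal q + length ss
antidiagonal-endpoint q []       = sym (+-identityʳ _)
antidiagonal-endpoint q (s ∷ ss) = trans (antidiagonal-endpoint (move q s) ss)
  (trans (cong (_+ length ss) (antidiagonal-move q s)) (sym (+-suc _ (length ss))))

antidiagonal-pointAt : ∀ q ss {j} → j ≤ length ss → antidiagonal (pointAt q ss j) ≡ antidiagonal q + j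
antidiagonal-pointAt q ss       {zero}  _        = sym (+-identityʳ _)
antidiagonal-pointAt q (s ∷ ss) {suc j} (s≤s le) = trans (antidiagonal-pointAt (move q s) ss le)
  (trans (cong (_+ j) (antidiagonal-move q s)) (sym (+-suc _ j)))

north : ℕ → List Step → ℕ
north zero    _        = 0
north (suc j) []       = 0
north (suc j) (E ∷ ss) = north j ss
north (suc j) (N ∷ ss) = suc (north j ss)

north-up : ∀ ss j → north j ss ≤ north (suc j) ss
north-up ss       zero    = z≤n
north-up []       (suc j) = z≤n
north-up (E ∷ ss) (suc j) = north-up ss j
north-up (N ∷ ss) (suc j) = s≤s (north-up ss j)

north-step : ∀ ss j → north (suc j) ss ≤ suc (north j ss)
north-step []       j       = z≤n
north-step (E ∷ ss) zero    = z≤n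
north-step (N ∷ ss) zero    = ≤-refl
north-step (E ∷ ss) (suc j) = north-step ss j
north-step (N ∷ ss) (suc j) = s≤s (north-step ss j)

height-pointAt : ∀ q ss j → proj₂ (pointAt q ss j) ≡ proj₂ q + north j ss
height-pointAt q ss       zero    = sym (+-identityʳ _)
height-pointAt q []       (suc j) = sym (+-identityʳ _)
height-pointAt q (E ∷ ss) (suc j) = height-pointAt (move q E) ss j
height-pointAt q (N ∷ ss) (suc j) = trans (height-pointAt (move q N) ss j) (sym (+-suc _ _))

height-endpoint : ∀ q ss → proj₂ (endpoint q ss) ≡ proj₂ q + north (length ss) ss
height-endpoint q ss = trans (cong (λ u → proj₂ (endpoint q u)) (sym (take-all _ ss ≤-refl)))
  (height-pointAt q ss (length ss))

module _ {R : Point → Set} where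
  all-points⁻ : ∀ q ss → All R (points q ss) → ∀ j → R (pointAt q ss j)
  all-points⁻ q []       (r ∷ _)  zero    = r
  all-points⁻ q []       (r ∷ _)  (suc j) = r
  all-points⁻ q (s ∷ ss) (r ∷ _)  zero    = r
  all-points⁻ q (s ∷ ss) (_ ∷ rs) (suc j) = all-points⁻ (move q s) ss rs j

  all-points⁺ : ∀ q ss → (∀ j → j ≤ length ss → R (pointAt q ss j)) → All R (points q ss)
  all-points⁺ q []       h = h 0 z≤n ∷ []
  all-points⁺ q (s ∷ ss) h = h 0 z≤n ∷ all-points⁺ (move q s) ss (λ j j≤ → h (suc j) (s≤s j≤))

StepsNorthAt : List Step → ℕ → Set
StepsNorthAt ss j = ∃ λ rest → drop j ss ≡ N ∷ rest

drop-∷⇒≤ : ∀ {s : Step} {rest} ss j → drop j ss ≡ s ∷ rest → j ≤ length ss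
drop-∷⇒≤ ss       zero    _  = z≤n
drop-∷⇒≤ (_ ∷ ss) (suc j) eq = s≤s (drop-∷⇒≤ ss j eq)

toSteps : ∀ {n} → Subset n → List Step
toSteps []            = []
toSteps (inside ∷ B)  = N ∷ toSteps B
toSteps (outside ∷ B) = E ∷ toSteps B

length-toSteps : ∀ {n} (B : Subset n) → length (toSteps B) ≡ n
length-toSteps []            = refl
length-toSteps (inside ∷ B)  = cong suc (length-toSteps B)
length-toSteps (outside ∷ B) = cong suc (length-toSteps B)

north-toSteps : ∀ {n} (B : Subset n) j → north j (toSteps B) ≡ count< B j
north-toSteps []            zero    = refl
north-toSteps []            (suc j) = refl
north-toSteps (_ ∷ B)       zero    = refl
north-toSteps (inside ∷ B)  (suc j) = cong suc (north-toSteps B j)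
north-toSteps (outside ∷ B) (suc j) = north-toSteps B j

toSteps-∈ : ∀ {n} {B : Subset n} {e} → e ∈ B → StepsNorthAt (toSteps B) (toℕ e)
toSteps-∈ {B = _ ∷ B}       here       = toSteps B , refl
toSteps-∈ {B = inside ∷ _}  (there e∈) = toSteps-∈ e∈
toSteps-∈ {B = outside ∷ _} (there e∈) = toSteps-∈ e∈

toSteps-∋ : ∀ {n} (B : Subset n) {j} → StepsNorthAt (toSteps B) j → ∃ λ e → toℕ e ≡ j × e ∈ B
toSteps-∋ []            {zero}  (_ , ())
toSteps-∋ []            {suc j} (_ , ())
toSteps-∋ (inside ∷ B)  {zero}  _ = zero , refl , here
toSteps-∋ (outside ∷ B) {zero}  (_ , ())
toSteps-∋ (inside ∷ B)  {suc j} at =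
  let e , eq , e∈ = toSteps-∋ B at in suc e , cong suc eq , there e∈
toSteps-∋ (outside ∷ B) {suc j} at =
  let e , eq , e∈ = toSteps-∋ B at in suc e , cong suc eq , there e∈

-- Recovers the steps of a b-path from its label-set, so that its heights become values of `count<`.
toSteps-unique : ∀ {n} (B : Subset n) ss → length ss ≡ n →
  (∀ {j} → StepsNorthAt ss j → ∃ λ e → toℕ e ≡ j × e ∈ B) →
  (∀ {e} → e ∈ B → StepsNorthAt ss (toℕ e)) → ss ≡ toSteps B
toSteps-unique []      []       len sound complete = refl
toSteps-unique (b ∷ B) (s ∷ ss) len sound complete = cons b s sound complete
  where
  tail≡ : ∀ {b s} →
    (∀ {j} → StepsNorthAt (s ∷ ss) j → ∃ λ e → toℕ e ≡ j × e ∈ (b ∷ B)) →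
    (∀ {e} → e ∈ (b ∷ B) → StepsNorthAt (s ∷ ss) (toℕ e)) → ss ≡ toSteps B
  tail≡ sound complete = toSteps-unique B ss (suc-injective len) (λ at → sound′ (sound at))
    (λ e∈ → complete (there e∈))
    where
    sound′ : ∀ {b j} → (∃ λ e → toℕ e ≡ suc j × e ∈ (b ∷ B)) → ∃ λ e → toℕ e ≡ j × e ∈ B
    sound′ (suc e , eq , there e∈) = e , suc-injective eq , e∈

  cons : ∀ b s →
    (∀ {j} → StepsNorthAt (s ∷ ss) j → ∃ λ e → toℕ e ≡ j × e ∈ (b ∷ B)) →
    (∀ {e} → e ∈ (b ∷ B) → StepsNorthAt (s ∷ ss) (toℕ e)) → s ∷ ss ≡ toSteps (b ∷ B)
  cons inside  N sound complete = cong (N ∷_) (tail≡ sound complete)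
  cons outside E sound complete = cong (E ∷_) (tail≡ sound complete)
  cons inside  E sound complete with complete here
  ... | _ , ()
  cons outside N sound complete with sound {0} (ss , refl)
  ... | zero , _ , ()

-- Diagrams: b-paths as fitting subsets

module _ (D : Diagram) where
  open Diagram D

  private
    n : ℕ
    n = m + r

    f g : ℕ → ℕ
    f j = north j P
    g j = k ∸ 1 + north j Q

    height-P : ∀ j → proj₂ (pointAt (k ∸ 1 , 0) P j) ≡ f j
    height-P = height-pointAt (k ∸ 1 , 0) P

    height-Q : ∀ j → proj₂ (pointAt (0 , k ∸ 1) Q j) ≡ g j
    height-Q = height-pointAt (0 , k ∸ 1) Q

    -- Every step advances the antidiagonal by 1, and the endpoint lies `m + r` antidiagonals
    -- further on.
    length-path : ∀ q ss {x y} → endpoint q ss ≡ (x + m , y + r) → x + y ≡ antidiagonal q →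
      length ss ≡ n
    length-path q ss {x} {y} eq diag = +-cancelˡ-≡ (antidiagonal q) _ _ (begin
      antidiagonal q + length ss     ≡⟨ antidiagonal-endpoint q ss ⟨
      antidiagonal (endpoint q ss)   ≡⟨ cong antidiagonal eq ⟩
      x + m + (y + r)                ≡⟨ swap x m y r ⟩
      x + y + (m + r)                ≡⟨ cong (_+ n) diag ⟩
      antidiagonal q + n             ∎)
      where
      open ≡-Reasoning
      swap : ∀ a b c d → a + b + (c + d) ≡ a + c + (b + d)
      swap = solve-∀

    length-P : length P ≡ n
    length-P = length-path (k ∸ 1 , 0) P {k ∸ 1} {0} P-path refl

    length-Q : length Q ≡ n
    length-Q = length-path (0 , k ∸ 1) Q {0} {k ∸ 1} Q-path refl

    north-path : ∀ q ss → length ss ≡ n → proj₂ (endpoint q ss) ≡ proj₂ q + r → north n ss ≡ r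
    north-path q ss len eq = +-cancelˡ-≡ (proj₂ q) _ _
      (trans (cong (λ l → proj₂ q + north l ss) (sym len)) (trans (sym (height-endpoint q ss)) eq))

  boundary-heights : Heights (m + r) r f g
  boundary-heights = record
    { f-zero = refl
    ; f-n    = north-path (k ∸ 1 , 0) P length-P (cong proj₂ P-path)
    ; g-n    = cong₂ _+_ (sym (+-identityʳ (k ∸ 1)))
                 (north-path (0 , k ∸ 1) Q length-Q (cong proj₂ Q-path))
    ; f-up   = north-up P
    ; g-up   = λ x → +-monoʳ-≤ (k ∸ 1) (north-up Q x)
    ; f-step = north-step P
    ; g-step = λ x → ≤-trans (+-monoʳ-≤ (k ∸ 1) (north-step Q x)) (≤-reflexive (+-suc (k ∸ 1) _))
    ; f≤g    = λ x → subst₂ _≤_ (height-P x) (height-Q x) (Q-not-below-P x)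
    }

  private
    antidiagonal-p : ∀ {i} → 1 ≤ i → i ≤ k → antidiagonal (p D i) ≡ k ∸ 1
    antidiagonal-p {suc a} _ sa≤k = begin
      k ∸ suc a + a         ≡⟨ cong (_+ a) (∸-+-assoc k 1 a) ⟨
      k ∸ 1 ∸ a + a         ≡⟨ m∸n+n≡m (∸-monoˡ-≤ 1 sa≤k) ⟩
      k ∸ 1                 ∎
      where open ≡-Reasoning

    module _ {q : Point} {ss : List Step} (q∈L : antidiagonal q ≡ k ∸ 1) {j : ℕ} (j≤ : j ≤ length ss) where
      -- `InRegion` finds the boundary heights through the antidiagonal; for a path from `L` this
      -- recovers the step number.
      offset : antidiagonal (pointAt q ss j) ∸ (k ∸ 1) ≡ j
      offset = trans (cong (_∸ (k ∸ 1)) (trans (antidiagonal-pointAt q ss j≤) (cong (_+ j) q∈L)))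
                 (m+n∸m≡n (k ∸ 1) j)

      inRegion⁻ : InRegion D (pointAt q ss j) → f j ≤ proj₂ q + north j ss × proj₂ q + north j ss ≤ g j
      inRegion⁻ (_ , _ , lower , upper) =
        subst₂ _≤_ (trans (cong (λ i → proj₂ (pointAt _ P i)) offset) (height-P j))
          (height-pointAt q ss j) lower ,
        subst₂ _≤_ (height-pointAt q ss j)
          (trans (cong (λ i → proj₂ (pointAt _ Q i)) offset) (height-Q j)) upper

      inRegion⁺ : length ss ≡ n → f j ≤ proj₂ q + north j ss → proj₂ q + north j ss ≤ g j →
        InRegion D (pointAt q ss j)
      inRegion⁺ len lower upper =
        ≤-trans (m≤m+n (k ∸ 1) j) (≤-reflexive (sym diag)) ,
        ≤-trans (≤-reflexive diag) (+-monoʳ-≤ (k ∸ 1) (≤-trans j≤ (≤-reflexive len))) ,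
        subst₂ _≤_ (sym (trans (cong (λ i → proj₂ (pointAt _ P i)) offset) (height-P j)))
          (sym (height-pointAt q ss j)) lower ,
        subst₂ _≤_ (sym (height-pointAt q ss j))
          (sym (trans (cong (λ i → proj₂ (pointAt _ Q i)) offset) (height-Q j))) upper
        where
        diag : antidiagonal (pointAt q ss j) ≡ k ∸ 1 + j
        diag = trans (antidiagonal-pointAt q ss j≤) (cong (_+ j) q∈L)

    module _ (π : BPath D) where
      open BPath π

      -- The path witnessing a label may differ from `π`, but both start on `L`, so they reach the
      -- common point after equally many steps.
      label⁻ : ∀ {ℓ} → InLabelSet D π ℓ → ∃ λ j → ℓ ≡ suc j × StepsNorthAt steps j
      label⁻ {suc i} (q , (j , rest , dropj , at) , st , ss , rest′ , st∈L , _ , at′ , dropi) =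
        j , cong suc (+-cancelˡ-≡ (k ∸ 1) _ _ (begin
          k ∸ 1 + i                                  ≡⟨ cong (_+ i) st∈L ⟨
          antidiagonal st + i                        ≡⟨ antidiagonal-pointAt st ss (drop-∷⇒≤ ss i dropi) ⟨
          antidiagonal (pointAt st ss i)             ≡⟨ cong antidiagonal (trans at′ (sym at)) ⟩
          antidiagonal (pointAt (p D idx) steps j)
            ≡⟨ antidiagonal-pointAt (p D idx) steps (drop-∷⇒≤ steps j dropj) ⟩
          antidiagonal (p D idx) + j                 ≡⟨ cong (_+ j) (antidiagonal-p idx≥1 idx≤k) ⟩
          k ∸ 1 + j                                  ∎)) ,
        rest , dropj
        where open ≡-Reasoning

      label⁺ : ∀ {j} → StepsNorthAt steps j → InLabelSet D π (suc j)
      label⁺ {j} (rest , eq) =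
        pointAt (p D idx) steps j , (j , rest , eq , refl) ,
        p D idx , steps , rest , antidiagonal-p idx≥1 idx≤k , s≤s z≤n , refl , eq

  inB⇒fits : ∀ B → InB D B → Fits r f g B
  inB⇒fits B (π , labels) = ∣B∣≡r , idx ∸ 1 , λ j j≤n →
    subst (λ h → f j ≤ idx ∸ 1 + h × idx ∸ 1 + h ≤ g j) (north≡count j)
      (inRegion⁻ p∈L (≤-trans j≤n (≤-reflexive (sym len))) (all-points⁻ (p D idx) steps inRegion j))
    where
    open BPath π
    p∈L = antidiagonal-p idx≥1 idx≤k

    len : length steps ≡ n
    len = length-path (p D idx) steps {k ∸ idx} {idx ∸ 1} ends refl

    steps≡ : steps ≡ toSteps B
    steps≡ = toSteps-unique B steps len
      (λ at → let e , eq , e∈ = Equivalence.to (labels _) (label⁺ π at) in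
              e , sym (suc-injective eq) , e∈)
      (λ {e} e∈ → let j , eq , at = label⁻ π (Equivalence.from (labels _) (e , refl , e∈)) in
              subst (StepsNorthAt steps) (sym (suc-injective eq)) at)

    north≡count : ∀ j → north j steps ≡ count< B j
    north≡count j = trans (cong (north j) steps≡) (north-toSteps B j)

    ∣B∣≡r : ∣ B ∣ ≡ r
    ∣B∣≡r = trans (sym (count<-all B)) (trans (sym (north≡count n))
      (north-path (p D idx) steps len (cong proj₂ ends)))

  fits⇒inB : ∀ B → Fits r f g B → InB D B
  fits⇒inB B (∣B∣≡r , a , fit) = π , λ ℓ → mk⇔
    (λ ∈label → let j , ℓ≡ , at = label⁻ π ∈label
                    e , e≡ , e∈ = toSteps-∋ B at
                in e , trans ℓ≡ (cong suc (sym e≡)) , e∈)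
    (λ (e , ℓ≡ , e∈) → subst (InLabelSet D π) (sym ℓ≡) (label⁺ π (toSteps-∈ e∈)))
    where
    open ≡-Reasoning
    len = length-toSteps B

    -- At `j = 0` the upper bound reads `a ≤ k ∸ 1`, so `suc a` is a valid index of a starting
    -- point.
    a<k : suc a ≤ k
    a<k = ≤-trans
      (s≤s (≤-trans (m≤m+n a (count< B 0))
        (≤-trans (proj₂ (fit 0 z≤n)) (≤-reflexive (+-identityʳ (k ∸ 1))))))
      (≤-reflexive (m+[n∸m]≡n k≥1))

    p∈L = antidiagonal-p (s≤s z≤n) a<k

    end = endpoint (p D (suc a)) (toSteps B)

    end-height : proj₂ end ≡ a + r
    end-height = begin
      proj₂ end                                     ≡⟨ height-endpoint (p D (suc a)) (toSteps B) ⟩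
      a + north (length (toSteps B)) (toSteps B)    ≡⟨ cong (a +_) (north-toSteps B _) ⟩
      a + count< B (length (toSteps B))                  ≡⟨ cong (λ l → a + count< B l) len ⟩
      a + count< B n                                     ≡⟨ cong (a +_) (trans (count<-all B) ∣B∣≡r) ⟩
      a + r                                         ∎

    -- The antidiagonal of the endpoint is known from the length, so the height determines the
    -- width.
    end-width : proj₁ end ≡ k ∸ suc a + m
    end-width = +-cancelʳ-≡ (a + r) _ _ (begin
      proj₁ end + (a + r)                   ≡⟨ cong (proj₁ end +_) end-height ⟨
      antidiagonal end                      ≡⟨ antidiagonal-endpoint (p D (suc a)) (toSteps B) ⟩
      k ∸ suc a + a + length (toSteps B)    ≡⟨ cong (k ∸ suc a + a +_) len ⟩
      k ∸ suc a + a + (m + r)               ≡⟨ swap (k ∸ suc a) a m r ⟩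
      k ∸ suc a + m + (a + r)               ∎)
      where
      swap : ∀ a b c d → a + b + (c + d) ≡ a + c + (b + d)
      swap = solve-∀

    π : BPath D
    π = record
      { idx      = suc a
      ; idx≥1    = s≤s z≤n
      ; idx≤k    = a<k
      ; steps    = toSteps B
      ; ends     = cong₂ _,_ end-width end-height
      ; inRegion = all-points⁺ (p D (suc a)) (toSteps B) λ j j≤ →
          let lower , upper = subst (λ h → f j ≤ a + h × a + h ≤ g j) (sym (north-toSteps B j))
                                (fit j (≤-trans j≤ (≤-reflexive len)))
          in inRegion⁺ p∈L j≤ len lower upper
      }

theorem3p7 : (D : Diagram) → IsMultiPathBases (InB D)
theorem3p7 D = multiPath-resp-⇔ (λ B → mk⇔ (inB⇒fits D B) (fits⇒inB D B))
  (fits-multiPath (Diagram.r D) (boundary-heights D))
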